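{- Let $k,q$ be positive integers and let $a>0$. Then $$ \sum_{n=0}^{\infty}\frac{(-1)^n}{(n+a)^{4k(q+1)}}\sum_{i=0}^{\infty}\frac{(-1)^i(n+a)^{2k}}{(n+a)^{2k}+(i+a)^{2k}} =\frac12\sum_{p=1}^{2q+1}(-1)^{p+1}\zeta_E(2kp,a)\,\zeta_E\bigl(2k(2q-p+2),a\bigr). $$
   Context: The alternating Hurwitz zeta function is $\zeta_E(z,x)=\sum_{n=0}^{\infty}\frac{(-1)^n}{(n+x)^z}$ for $\operatorname{Re}(z)>0$ and $x\neq0,-1,-2,\dots$. -}

module Defs where

open import Data.Nat as ℕ using (ℕ; zero; suc; z≤n; s≤s; NonZero)
import Data.Nat.Properties as ℕ
open import Data.Integer as ℤ using (+_; -[1+_]; +[1+_]; +0)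
import Data.Integer.Properties as ℤ
import Data.Rational.Unnormalised as ℚᵘ
import Data.Rational.Unnormalised.Properties as ℚᵘ
open import Data.Rational as ℚ using (ℚ; mkℚ; 0ℚ; 1ℚ; ½)
import Data.Rational.Properties as ℚ
open import Data.Rational.Solver using (module +-*-Solver)
import Algebra.Definitions.RawSemiring as RawSemiringDefs
open import Data.Product using (∃-syntax; _×_; _,_; proj₁; proj₂)
open import Data.Sum using (_⊎_; inj₁; inj₂)
open import Relation.Nullary using (yes; no; contradiction)
open import Relation.Binary.PropositionalEquality using (_≡_; _≢_; refl; sym; trans; cong; cong₂; subst; subst₂)

------------------------------------------------------------------------
-- Rationals

module ℚPow = RawSemiringDefs ℚ.+-*-rawSemiring

-- Totalised reciprocal, with value 0 at 0.
recip : ℚ → ℚ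
recip p with p ℚ.≟ 0ℚ
... | yes _   = 0ℚ
... | no p≢0 = (ℚ.1/ p) {{ℚ.≢-nonZero p≢0}}

open +-*-Solver using (solve; _:=_; _:+_; _:*_; :-_; _:-_; con)

<⇒≢0 : ∀ {p} → 0ℚ ℚ.< p → p ≢ 0ℚ
<⇒≢0 0<p refl = ℚ.<-irrefl refl 0<p

recip-* : ∀ {p} → 0ℚ ℚ.< p → recip p ℚ.* p ≡ 1ℚ
recip-* {p} 0<p with p ℚ.≟ 0ℚ
... | yes p≡0 = contradiction p≡0 (<⇒≢0 0<p)
... | no p≢0 = ℚ.*-inverseˡ p {{ℚ.≢-nonZero p≢0}}

recip-pos : ∀ {p} → 0ℚ ℚ.< p → 0ℚ ℚ.< recip p
recip-pos {p} 0<p with p ℚ.≟ 0ℚ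
... | yes p≡0 = contradiction p≡0 (<⇒≢0 0<p)
... | no p≢0 = ℚ.positive⁻¹ _ {{ℚ.1/pos⇒pos p {{ℚ.positive 0<p}}}}

*-mono-≤ : ∀ {a b c d} → 0ℚ ℚ.≤ c → 0ℚ ℚ.≤ b → a ℚ.≤ b → c ℚ.≤ d → a ℚ.* c ℚ.≤ b ℚ.* d
*-mono-≤ {a} {b} {c} {d} 0≤c 0≤b a≤b c≤d = ℚ.≤-trans
  (ℚ.*-monoʳ-≤-nonNeg c {{ℚ.nonNegative 0≤c}} a≤b)
  (ℚ.*-monoˡ-≤-nonNeg b {{ℚ.nonNegative 0≤b}} c≤d)

*-pos : ∀ {p q} → 0ℚ ℚ.< p → 0ℚ ℚ.< q → 0ℚ ℚ.< p ℚ.* q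
*-pos {p} {q} 0<p 0<q =
  ℚ.positive⁻¹ _ {{ℚ.pos*pos⇒pos p {{ℚ.positive 0<p}} q {{ℚ.positive 0<q}}}}

+-pos : ∀ {p q} → 0ℚ ℚ.< p → 0ℚ ℚ.< q → 0ℚ ℚ.< p ℚ.+ q
+-pos {p} {q} 0<p 0<q =
  ℚ.positive⁻¹ _ {{ℚ.pos+pos⇒pos p {{ℚ.positive 0<p}} q {{ℚ.positive 0<q}}}}

0<½ : 0ℚ ℚ.< ½
0<½ = ℚ.positive⁻¹ ½

0<1 : 0ℚ ℚ.< 1ℚ
0<1 = ℚ.positive⁻¹ 1ℚ

½-pos : ∀ {p} → 0ℚ ℚ.< p → 0ℚ ℚ.< ½ ℚ.* p
½-pos = *-pos 0<½

½+½ : ∀ p → ½ ℚ.* p ℚ.+ ½ ℚ.* p ≡ p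
½+½ p = trans (sym (ℚ.*-distribʳ-+ p ½ ½)) (ℚ.*-identityˡ p)

p≤∣p∣ : ∀ p → p ℚ.≤ ℚ.∣ p ∣
p≤∣p∣ p with ℚ.≤-total 0ℚ p
... | inj₁ 0≤p = ℚ.≤-reflexive (sym (ℚ.0≤p⇒∣p∣≡p 0≤p))
... | inj₂ p≤0 = ℚ.≤-trans p≤0 (ℚ.0≤∣p∣ p)

∣∣≤ : ∀ {p c} → p ℚ.≤ c → ℚ.- p ℚ.≤ c → ℚ.∣ p ∣ ℚ.≤ c
∣∣≤ {p} p≤c -p≤c with ℚ.∣p∣≡p∨∣p∣≡-p p
... | inj₁ e = ℚ.≤-trans (ℚ.≤-reflexive e) p≤c
... | inj₂ e = ℚ.≤-trans (ℚ.≤-reflexive e) -p≤c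

∣-∣-swap : ∀ p q → ℚ.∣ p ℚ.- q ∣ ≡ ℚ.∣ q ℚ.- p ∣
∣-∣-swap p q = trans
  (cong ℚ.∣_∣ (solve 2 (λ p q → p :- q := :- (q :- p)) refl p q)) (ℚ.∣-p∣≡∣p∣ (q ℚ.- p))

triangle : ∀ p q r → ℚ.∣ p ℚ.- r ∣ ℚ.≤ ℚ.∣ p ℚ.- q ∣ ℚ.+ ℚ.∣ q ℚ.- r ∣
triangle p q r = ℚ.≤-trans
  (ℚ.≤-reflexive (cong ℚ.∣_∣ (solve 3 (λ p q r → p :- r := (p :- q) :+ (q :- r)) refl p q r)))
  (ℚ.∣p+q∣≤∣p∣+∣q∣ (p ℚ.- q) (q ℚ.- r))

∣∣-lip : ∀ p q → ℚ.∣ ℚ.∣ p ∣ ℚ.- ℚ.∣ q ∣ ∣ ℚ.≤ ℚ.∣ p ℚ.- q ∣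
∣∣-lip p q = ∣∣≤ (half p q) (ℚ.≤-trans
    (ℚ.≤-reflexive (solve 2 (λ a b → :- (a :- b) := b :- a) refl ℚ.∣ p ∣ ℚ.∣ q ∣))
    (ℚ.≤-trans (half q p) (ℚ.≤-reflexive (∣-∣-swap q p))))
  where
  half : ∀ p q → ℚ.∣ p ∣ ℚ.- ℚ.∣ q ∣ ℚ.≤ ℚ.∣ p ℚ.- q ∣
  half p q = ℚ.≤-trans
    (ℚ.+-monoˡ-≤ (ℚ.- ℚ.∣ q ∣) (ℚ.≤-trans
      (ℚ.≤-reflexive (cong ℚ.∣_∣ (solve 2 (λ p q → p := (p :- q) :+ q) refl p q)))
      (ℚ.∣p+q∣≤∣p∣+∣q∣ (p ℚ.- q) q)))
    (ℚ.≤-reflexive (solve 2 (λ a b → (a :+ b) :- b := a) refl ℚ.∣ p ℚ.- q ∣ ℚ.∣ q ∣))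

p≤q+p : ∀ {p q} → 0ℚ ℚ.≤ q → p ℚ.≤ q ℚ.+ p
p≤q+p {p} 0≤q = ℚ.≤-trans (ℚ.≤-reflexive (sym (ℚ.+-identityˡ p))) (ℚ.+-monoˡ-≤ p 0≤q)

p≤p+q : ∀ {p q} → 0ℚ ℚ.≤ q → p ℚ.≤ p ℚ.+ q
p≤p+q {p} 0≤q = ℚ.≤-trans (ℚ.≤-reflexive (sym (ℚ.+-identityʳ p))) (ℚ.+-monoʳ-≤ p 0≤q)

------------------------------------------------------------------------
-- Real numbers

-- A real number is a Cauchy sequence of rationals together with a modulus.
-- Two representatives denote the same real when _≃_ relates them. Eta is
-- switched off so that instance search compares reals structurally.
record ℝ : Set where
  no-eta-equality
  field
    seq    : ℕ → ℚ
    cauchy : ∀ ε → 0ℚ ℚ.< ε →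
             ∃[ N ] ∀ m n → N ℕ.≤ m → N ℕ.≤ n → ℚ.∣ seq m ℚ.- seq n ∣ ℚ.≤ ε
open ℝ public

infix 4 _≃_ _<_

_≃_ : ℝ → ℝ → Set
x ≃ y = ∀ ε → 0ℚ ℚ.< ε → ∃[ N ] ∀ n → N ℕ.≤ n → ℚ.∣ seq x n ℚ.- seq y n ∣ ℚ.≤ ε

record _<_ (x y : ℝ) : Set where
  constructor mk<
  field
    gap    : ℚ
    0<gap  : 0ℚ ℚ.< gap
    from   : ℕ
    gap≤   : ∀ n → from ℕ.≤ n → seq x n ℚ.+ gap ℚ.≤ seq y n

⊔ˡ : ∀ {a b n} → a ℕ.⊔ b ℕ.≤ n → a ℕ.≤ n
⊔ˡ {a} {b} = ℕ.m⊔n≤o⇒m≤o a b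

⊔ʳ : ∀ {a b n} → a ℕ.⊔ b ℕ.≤ n → b ℕ.≤ n
⊔ʳ {a} {b} = ℕ.m⊔n≤o⇒n≤o a b

-- A modulus for x * y needs eventual bounds on both factors.
bounded : (x : ℝ) → ∃[ B ] 0ℚ ℚ.< B × (∃[ N ] ∀ n → N ℕ.≤ n → ℚ.∣ seq x n ∣ ℚ.≤ B)
bounded x with cauchy x 1ℚ 0<1
... | N , p = 1ℚ ℚ.+ ℚ.∣ seq x N ∣
  , ℚ.<-≤-trans 0<1 (p≤p+q (ℚ.0≤∣p∣ (seq x N))) , N
  , λ n N≤n → ℚ.≤-trans
      (ℚ.≤-reflexive (cong ℚ.∣_∣ (solve 2 (λ a b → a := (a :- b) :+ b) refl (seq x n) (seq x N))))
      (ℚ.≤-trans (ℚ.∣p+q∣≤∣p∣+∣q∣ (seq x n ℚ.- seq x N) (seq x N))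
        (ℚ.+-monoˡ-≤ ℚ.∣ seq x N ∣ (p n N N≤n ℕ.≤-refl)))

infixl 6 _+_ _-_
infixl 7 _*_ _/_
infix  8 -_ _⁻¹
infixr 9 _^_

fromℚ : ℚ → ℝ
seq    (fromℚ p) _ = p
cauchy (fromℚ p) ε 0<ε = 0 , λ _ _ _ _ →
  subst (ℚ._≤ ε) (cong ℚ.∣_∣ (sym (ℚ.+-inverseʳ p))) (ℚ.<⇒≤ 0<ε)

fromℕ : ℕ → ℝ
seq    (fromℕ n) _ = + n ℚ./ 1
cauchy (fromℕ n) = cauchy (fromℚ (+ n ℚ./ 1))

0ℝ 1ℝ : ℝ
0ℝ = fromℚ 0ℚ
1ℝ = fromℚ 1ℚ

_+_ : ℝ → ℝ → ℝ
seq    (x + y) n = seq x n ℚ.+ seq y n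
cauchy (x + y) ε 0<ε with cauchy x (½ ℚ.* ε) (½-pos 0<ε) | cauchy y (½ ℚ.* ε) (½-pos 0<ε)
... | M , p | N , q = M ℕ.⊔ N , λ m n M≤ N≤ → ℚ.≤-trans
  (ℚ.≤-reflexive (cong ℚ.∣_∣
    (solve 4 (λ a b c d → (a :+ b) :- (c :+ d) := (a :- c) :+ (b :- d)) refl
      (seq x m) (seq y m) (seq x n) (seq y n))))
  (ℚ.≤-trans (ℚ.∣p+q∣≤∣p∣+∣q∣ (seq x m ℚ.- seq x n) (seq y m ℚ.- seq y n))
    (ℚ.≤-trans (ℚ.+-mono-≤ (p m n (⊔ˡ M≤) (⊔ˡ N≤)) (q m n (⊔ʳ {M} M≤) (⊔ʳ {M} N≤)))
      (ℚ.≤-reflexive (½+½ ε))))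

-_ : ℝ → ℝ
seq    (- x) n = ℚ.- seq x n
cauchy (- x) ε 0<ε with cauchy x ε 0<ε
... | N , p = N , λ m n N≤m N≤n → ℚ.≤-trans
  (ℚ.≤-reflexive (cong ℚ.∣_∣
    (solve 2 (λ a b → (:- a) :- (:- b) := b :- a) refl (seq x m) (seq x n))))
  (p n m N≤n N≤m)

_-_ : ℝ → ℝ → ℝ
x - y = x + (- y)

-- ∣ab - cd∣ ≤ ∣a∣∣b - d∣ + ∣d∣∣a - c∣
*-estimate : ∀ {a b c d B C e} → 0ℚ ℚ.≤ B → 0ℚ ℚ.≤ C → ℚ.∣ a ∣ ℚ.≤ B → ℚ.∣ d ∣ ℚ.≤ C →
  ℚ.∣ a ℚ.- c ∣ ℚ.≤ e → ℚ.∣ b ℚ.- d ∣ ℚ.≤ e → ℚ.∣ a ℚ.* b ℚ.- c ℚ.* d ∣ ℚ.≤ e ℚ.* (B ℚ.+ C)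
*-estimate {a} {b} {c} {d} {B} {C} {e} 0≤B 0≤C a≤ d≤ a-c≤ b-d≤ = begin
  ℚ.∣ a ℚ.* b ℚ.- c ℚ.* d ∣
    ≡⟨ cong ℚ.∣_∣ (solve 4 (λ a b c d → a :* b :- c :* d := a :* (b :- d) :+ d :* (a :- c)) refl a b c d) ⟩
  ℚ.∣ a ℚ.* (b ℚ.- d) ℚ.+ d ℚ.* (a ℚ.- c) ∣
    ≤⟨ ℚ.∣p+q∣≤∣p∣+∣q∣ (a ℚ.* (b ℚ.- d)) (d ℚ.* (a ℚ.- c)) ⟩
  ℚ.∣ a ℚ.* (b ℚ.- d) ∣ ℚ.+ ℚ.∣ d ℚ.* (a ℚ.- c) ∣
    ≡⟨ cong₂ ℚ._+_ (ℚ.∣p*q∣≡∣p∣*∣q∣ a (b ℚ.- d)) (ℚ.∣p*q∣≡∣p∣*∣q∣ d (a ℚ.- c)) ⟩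
  ℚ.∣ a ∣ ℚ.* ℚ.∣ b ℚ.- d ∣ ℚ.+ ℚ.∣ d ∣ ℚ.* ℚ.∣ a ℚ.- c ∣
    ≤⟨ ℚ.+-mono-≤ (*-mono-≤ (ℚ.0≤∣p∣ (b ℚ.- d)) 0≤B a≤ b-d≤) (*-mono-≤ (ℚ.0≤∣p∣ (a ℚ.- c)) 0≤C d≤ a-c≤) ⟩
  B ℚ.* e ℚ.+ C ℚ.* e
    ≡⟨ solve 3 (λ B C e → B :* e :+ C :* e := e :* (B :+ C)) refl B C e ⟩
  e ℚ.* (B ℚ.+ C) ∎
  where open ℚ.≤-Reasoning

*-cauchy : ∀ x y ε → 0ℚ ℚ.< ε → ∃[ N ] ∀ m n → N ℕ.≤ m → N ℕ.≤ n →
  ℚ.∣ seq x m ℚ.* seq y m ℚ.- seq x n ℚ.* seq y n ∣ ℚ.≤ ε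
*-cauchy x y ε 0<ε = go (bounded x) (bounded y)
  where
  go : ∃[ B ] 0ℚ ℚ.< B × (∃[ N ] ∀ n → N ℕ.≤ n → ℚ.∣ seq x n ∣ ℚ.≤ B) →
       ∃[ C ] 0ℚ ℚ.< C × (∃[ N ] ∀ n → N ℕ.≤ n → ℚ.∣ seq y n ∣ ℚ.≤ C) →
       ∃[ N ] ∀ m n → N ℕ.≤ m → N ℕ.≤ n →
         ℚ.∣ seq x m ℚ.* seq y m ℚ.- seq x n ℚ.* seq y n ∣ ℚ.≤ ε
  go (B , 0<B , M₁ , b) (C , 0<C , M₂ , c) = combine (cauchy x e 0<e) (cauchy y e 0<e)
    where
    0<B+C : 0ℚ ℚ.< B ℚ.+ C
    0<B+C = +-pos 0<B 0<C
    e : ℚ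
    e = ε ℚ.* recip (B ℚ.+ C)
    0<e : 0ℚ ℚ.< e
    0<e = *-pos 0<ε (recip-pos 0<B+C)
    e* : e ℚ.* (B ℚ.+ C) ≡ ε
    e* = trans (ℚ.*-assoc ε (recip (B ℚ.+ C)) (B ℚ.+ C))
           (trans (cong (ε ℚ.*_) (recip-* 0<B+C)) (ℚ.*-identityʳ ε))
    combine : ∃[ N ] (∀ m n → N ℕ.≤ m → N ℕ.≤ n → ℚ.∣ seq x m ℚ.- seq x n ∣ ℚ.≤ e) →
              ∃[ N ] (∀ m n → N ℕ.≤ m → N ℕ.≤ n → ℚ.∣ seq y m ℚ.- seq y n ∣ ℚ.≤ e) →
              ∃[ N ] ∀ m n → N ℕ.≤ m → N ℕ.≤ n →
                ℚ.∣ seq x m ℚ.* seq y m ℚ.- seq x n ℚ.* seq y n ∣ ℚ.≤ ε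
    combine (N₁ , p) (N₂ , q) = (M₁ ℕ.⊔ M₂) ℕ.⊔ (N₁ ℕ.⊔ N₂) , λ m n ≤m ≤n →
      ℚ.≤-trans
        (*-estimate {seq x m} {seq y m} {seq x n} {seq y n} (ℚ.<⇒≤ 0<B) (ℚ.<⇒≤ 0<C)
          (b m (⊔ˡ (⊔ˡ {M₁ ℕ.⊔ M₂} ≤m)))
          (c n (⊔ʳ {M₁} (⊔ˡ {M₁ ℕ.⊔ M₂} ≤n)))
          (p m n (⊔ˡ (⊔ʳ {M₁ ℕ.⊔ M₂} ≤m)) (⊔ˡ (⊔ʳ {M₁ ℕ.⊔ M₂} ≤n)))
          (q m n (⊔ʳ {N₁} (⊔ʳ {M₁ ℕ.⊔ M₂} ≤m)) (⊔ʳ {N₁} (⊔ʳ {M₁ ℕ.⊔ M₂} ≤n))))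
        (ℚ.≤-reflexive e*)

_*_ : ℝ → ℝ → ℝ
seq    (x * y) n = seq x n ℚ.* seq y n
cauchy (x * y)   = *-cauchy x y

^-cauchy : ∀ x n ε → 0ℚ ℚ.< ε →
  ∃[ N ] ∀ i j → N ℕ.≤ i → N ℕ.≤ j → ℚ.∣ seq x i ℚPow.^ n ℚ.- seq x j ℚPow.^ n ∣ ℚ.≤ ε

_^_ : ℝ → ℕ → ℝ
seq    (x ^ n) j = seq x j ℚPow.^ n
cauchy (x ^ n)   = ^-cauchy x n

^-cauchy x zero    = cauchy 1ℝ
^-cauchy x (suc n) = cauchy (x * x ^ n)

∣_∣ : ℝ → ℝ
seq    ∣ x ∣ n = ℚ.∣ seq x n ∣
cauchy ∣ x ∣ ε 0<ε with cauchy x ε 0<ε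
... | N , p = N , λ m n N≤m N≤n → ℚ.≤-trans (∣∣-lip (seq x m) (seq x n)) (p m n N≤m N≤n)

-- Only reciprocals of positive reals are needed.
_⁻¹ : (x : ℝ) {{_ : 0ℝ < x}} → ℝ
seq    (x ⁻¹) n = recip (seq x n)
cauchy ((x ⁻¹) {{mk< δ 0<δ M δ≤}}) ε 0<ε with cauchy x (ε ℚ.* (δ ℚ.* δ)) (*-pos 0<ε (*-pos 0<δ 0<δ))
... | N , p = M ℕ.⊔ N , λ m n ≤m ≤n → ℚ.≤-trans
  (ℚ.≤-reflexive (trans (cong ℚ.∣_∣ (difference m n (⊔ˡ ≤m) (⊔ˡ ≤n)))
    (trans (ℚ.∣p*q∣≡∣p∣*∣q∣ (seq x n ℚ.- seq x m) (r m ℚ.* r n))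
      (cong (ℚ.∣ seq x n ℚ.- seq x m ∣ ℚ.*_) (ℚ.0≤p⇒∣p∣≡p
        (ℚ.<⇒≤ (*-pos (0<r m (⊔ˡ ≤m)) (0<r n (⊔ˡ ≤n)))))))))
  (ℚ.≤-trans
    (*-mono-≤ (ℚ.<⇒≤ (*-pos (0<r m (⊔ˡ ≤m)) (0<r n (⊔ˡ ≤n))))
      (ℚ.<⇒≤ (*-pos 0<ε (*-pos 0<δ 0<δ)))
      (p n m (⊔ʳ {M} ≤n) (⊔ʳ {M} ≤m))
      (*-mono-≤ (ℚ.<⇒≤ (0<r n (⊔ˡ ≤n))) (ℚ.<⇒≤ (recip-pos 0<δ)) (r≤ m (⊔ˡ ≤m)) (r≤ n (⊔ˡ ≤n))))
    (ℚ.≤-reflexive (trans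
      (solve 3 (λ e d t → (e :* (d :* d)) :* (t :* t) := e :* ((t :* d) :* (t :* d))) refl ε δ (recip δ))
      (trans (cong (λ t → ε ℚ.* (t ℚ.* t)) (recip-* 0<δ)) (ℚ.*-identityʳ ε)))))
  where
  r : ℕ → ℚ
  r n = recip (seq x n)
  δ≤x : ∀ n → M ℕ.≤ n → δ ℚ.≤ seq x n
  δ≤x n M≤n = ℚ.≤-trans (ℚ.≤-reflexive (sym (ℚ.+-identityˡ δ))) (δ≤ n M≤n)
  0<x : ∀ n → M ℕ.≤ n → 0ℚ ℚ.< seq x n
  0<x n M≤n = ℚ.<-≤-trans 0<δ (δ≤x n M≤n)
  0<r : ∀ n → M ℕ.≤ n → 0ℚ ℚ.< r n
  0<r n M≤n = recip-pos (0<x n M≤n)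
  difference : ∀ m n → M ℕ.≤ m → M ℕ.≤ n → r m ℚ.- r n ≡ (seq x n ℚ.- seq x m) ℚ.* (r m ℚ.* r n)
  difference m n M≤m M≤n = sym (trans
    (solve 4 (λ a b s t → (b :- a) :* (s :* t) := s :* (t :* b) :- t :* (s :* a)) refl
      (seq x m) (seq x n) (r m) (r n))
    (cong₂ ℚ._-_ (trans (cong (r m ℚ.*_) (recip-* (0<x n M≤n))) (ℚ.*-identityʳ (r m)))
                 (trans (cong (r n ℚ.*_) (recip-* (0<x m M≤m))) (ℚ.*-identityʳ (r n)))))
  r≤ : ∀ n → M ℕ.≤ n → r n ℚ.≤ recip δ
  r≤ n M≤n = subst₂ ℚ._≤_
    (trans (cong (ℚ._* r n) (recip-* 0<δ)) (ℚ.*-identityˡ (r n)))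
    (trans (ℚ.*-assoc (recip δ) (seq x n) (r n))
      (trans (cong (recip δ ℚ.*_) (trans (ℚ.*-comm (seq x n) (r n)) (recip-* (0<x n M≤n))))
        (ℚ.*-identityʳ (recip δ))))
    (ℚ.*-monoʳ-≤-nonNeg (r n) {{ℚ.nonNegative (ℚ.<⇒≤ (0<r n M≤n))}}
      (ℚ.*-monoˡ-≤-nonNeg (recip δ) {{ℚ.nonNegative (ℚ.<⇒≤ (recip-pos 0<δ))}} (δ≤x n M≤n)))

_/_ : (x y : ℝ) {{_ : 0ℝ < y}} → ℝ
x / y = x * y ⁻¹

instance
  n+x>0 : ∀ {n x} {{_ : 0ℝ < x}} → 0ℝ < fromℕ n + x
  n+x>0 {n} {{mk< δ 0<δ M δ≤}} = mk< δ 0<δ M λ i M≤i →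
    ℚ.≤-trans (δ≤ i M≤i) (p≤q+p (ℚ.nonNegative⁻¹ (+ n ℚ./ 1) {{ℚ.normalize-nonNeg n 1}}))

  x^n>0 : ∀ {x n} {{_ : 0ℝ < x}} → 0ℝ < x ^ n
  x^n>0 {x} {n} {{mk< δ 0<δ M δ≤}} = mk< (δ ℚPow.^ n) (0<^ n) M λ i M≤i →
    ℚ.≤-trans (ℚ.≤-reflexive (ℚ.+-identityˡ _)) (^-mono n i M≤i)
    where
    0<^ : ∀ n → 0ℚ ℚ.< δ ℚPow.^ n
    0<^ zero    = 0<1
    0<^ (suc n) = *-pos 0<δ (0<^ n)
    δ≤x : ∀ i → M ℕ.≤ i → δ ℚ.≤ seq x i
    δ≤x i M≤i = ℚ.≤-trans (ℚ.≤-reflexive (sym (ℚ.+-identityˡ δ))) (δ≤ i M≤i)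
    ^-mono : ∀ n i → M ℕ.≤ i → δ ℚPow.^ n ℚ.≤ seq x i ℚPow.^ n
    ^-mono zero    i M≤i = ℚ.≤-refl
    ^-mono (suc n) i M≤i = *-mono-≤ (ℚ.<⇒≤ (0<^ n))
      (ℚ.≤-trans (ℚ.<⇒≤ 0<δ) (δ≤x i M≤i)) (δ≤x i M≤i) (^-mono n i M≤i)

  x^m+y^n>0 : ∀ {x y m n} {{_ : 0ℝ < x}} {{_ : 0ℝ < y}} → 0ℝ < x ^ m + y ^ n
  x^m+y^n>0 {x} {y} {m} {n} = add (x^n>0 {x} {m}) (x^n>0 {y} {n})
    where
    add : ∀ {u v} → 0ℝ < u → 0ℝ < v → 0ℝ < u + v
    add (mk< δ 0<δ M δ≤) (mk< η 0<η N η≤) = mk< δ 0<δ (M ℕ.⊔ N) λ i ≤i →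
      ℚ.≤-trans (δ≤ i (⊔ˡ ≤i)) (p≤p+q (ℚ.≤-trans (ℚ.<⇒≤ 0<η)
        (ℚ.≤-trans (ℚ.≤-reflexive (sym (ℚ.+-identityˡ η))) (η≤ i (⊔ʳ {M} ≤i)))))

------------------------------------------------------------------------
-- Limits and series

infix 4 _⟶_ _sumsTo_

∑ : ℕ → (ℕ → ℝ) → ℝ
∑ zero    f = 0ℝ
∑ (suc n) f = ∑ n f + f n

syntax ∑ n (λ i → t) = ∑[ i < n ] t

_⟶_ : (ℕ → ℝ) → ℝ → Set
u ⟶ L = ∀ ε → 0ℝ < ε → ∃[ N ] ∀ n → N ℕ.≤ n → ∣ u n - L ∣ < ε

_sumsTo_ : (ℕ → ℝ) → ℝ → Set
f sumsTo S = (λ n → ∑[ i < n ] f i) ⟶ S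

Cauchy : (ℕ → ℝ) → Set
Cauchy u = ∀ ε → 0ℝ < ε → ∃[ N ] ∀ m n → N ℕ.≤ m → N ℕ.≤ n → ∣ u m - u n ∣ < ε

1/suc : ℕ → ℚ
1/suc n = + 1 ℚ./ suc n

1/suc-pos : ∀ n → 0ℚ ℚ.< 1/suc n
1/suc-pos n = ℚ.positive⁻¹ (1/suc n) {{ℚ.normalize-pos 1 (suc n)}}

archimedean : ∀ ε → 0ℚ ℚ.< ε → ∃[ N ] ∀ n → N ℕ.≤ n → 1/suc n ℚ.≤ ε
archimedean (mkℚ +[1+ p ] d c) _ = d , λ n d≤n → ℚ.toℚᵘ-cancel-≤
  (ℚᵘ.≤-trans (ℚᵘ.≤-reflexive (ℚ.toℚᵘ-fromℚᵘ (ℚᵘ.mkℚᵘ (+ 1) n)))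
    (ℚᵘ.*≤* (ℤ.+≤+ (ℕ.*-mono-≤ {1} {suc p} (s≤s z≤n) (s≤s d≤n)))))
archimedean (mkℚ +0 d c) (ℚ.*<* (ℤ.+<+ ()))
archimedean (mkℚ -[1+ p ] d c) (ℚ.*<* ())

quarter : ℚ → ℚ
quarter δ = ½ ℚ.* (½ ℚ.* δ)

quarter-pos : ∀ {δ} → 0ℚ ℚ.< δ → 0ℚ ℚ.< quarter δ
quarter-pos 0<δ = ½-pos (½-pos 0<δ)

quarters : ∀ δ → (quarter δ ℚ.+ quarter δ ℚ.+ quarter δ) ℚ.+ quarter δ ≡ δ
quarters δ = trans (solve 1 (λ t → (t :+ t :+ t) :+ t := (t :+ t) :+ (t :+ t)) refl (quarter δ))
  (trans (cong₂ ℚ._+_ (½+½ (½ ℚ.* δ)) (½+½ (½ ℚ.* δ))) (½+½ δ))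

triangle₃ : ∀ {a b c d e} → ℚ.∣ a ℚ.- b ∣ ℚ.≤ e → ℚ.∣ b ℚ.- c ∣ ℚ.≤ e → ℚ.∣ c ℚ.- d ∣ ℚ.≤ e →
  ℚ.∣ a ℚ.- d ∣ ℚ.≤ e ℚ.+ e ℚ.+ e
triangle₃ {a} {b} {c} {d} p q r = ℚ.≤-trans (triangle a c d)
  (ℚ.+-mono-≤ (ℚ.≤-trans (triangle a b c) (ℚ.+-mono-≤ p q)) r)

fromℚ-pos : ∀ {p} → 0ℚ ℚ.< p → 0ℝ < fromℚ p
fromℚ-pos {p} 0<p = mk< p 0<p 0 λ _ _ → ℚ.≤-reflexive (ℚ.+-identityˡ p)

drop-gap : ∀ {x y} (x<y : x < y) → ∀ n → _<_.from x<y ℕ.≤ n → seq x n ℚ.≤ seq y n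
drop-gap (mk< δ 0<δ M δ≤) n M≤n = ℚ.≤-trans (p≤p+q (ℚ.<⇒≤ 0<δ)) (δ≤ n M≤n)

-- The limit is the diagonal of rational approximations to u 0, u 1, u 2, …
-- with errors 1, 1/2, 1/3, …
complete : ∀ u → Cauchy u → ∃[ L ] u ⟶ L
complete u C = L , L-limit
  where
  at : ℕ → ℕ
  at j = proj₁ (cauchy (u j) (1/suc j) (1/suc-pos j))

  diag : ℕ → ℚ
  diag j = seq (u j) (at j)

  diag-error : ∀ {e} j m → 1/suc j ℚ.≤ e → at j ℕ.≤ m → ℚ.∣ diag j ℚ.- seq (u j) m ∣ ℚ.≤ e
  diag-error j m 1/j≤e at≤m =
    ℚ.≤-trans (proj₂ (cauchy (u j) (1/suc j) (1/suc-pos j)) (at j) m ℕ.≤-refl at≤m) 1/j≤e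

  module _ (δ : ℚ) (0<δ : 0ℚ ℚ.< δ) where
    e : ℚ
    e = quarter δ

    near : ∃[ N ] ∀ m n → N ℕ.≤ m → N ℕ.≤ n → ∣ u m - u n ∣ < fromℚ e
    near = C (fromℚ e) (fromℚ-pos (quarter-pos 0<δ))

    small : ∃[ N ] ∀ n → N ℕ.≤ n → 1/suc n ℚ.≤ e
    small = archimedean e (quarter-pos 0<δ)

    late : ℕ
    late = proj₁ near ℕ.⊔ proj₁ small

    close : ∀ i j → late ℕ.≤ i → late ℕ.≤ j →
      ∃[ M ] ∀ m → M ℕ.≤ m → ℚ.∣ seq (u i) m ℚ.- seq (u j) m ∣ ℚ.≤ e
    close i j ≤i ≤j = _<_.from p , drop-gap p
      where p = proj₂ near i j (⊔ˡ ≤i) (⊔ˡ ≤j)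

    1/≤ : ∀ i → late ℕ.≤ i → 1/suc i ℚ.≤ e
    1/≤ i ≤i = proj₂ small i (⊔ʳ {proj₁ near} ≤i)

    diag-cauchy : ∀ i j → late ℕ.≤ i → late ℕ.≤ j → ℚ.∣ diag i ℚ.- diag j ∣ ℚ.≤ δ
    diag-cauchy i j ≤i ≤j = ℚ.≤-trans
      (triangle₃ {diag i} {seq (u i) m} {seq (u j) m} {diag j}
        (diag-error i m (1/≤ i ≤i) (⊔ʳ {M} (⊔ˡ {M ℕ.⊔ at i} ℕ.≤-refl)))
        (proj₂ (close i j ≤i ≤j) m (⊔ˡ (⊔ˡ {M ℕ.⊔ at i} ℕ.≤-refl)))
        (ℚ.≤-trans (ℚ.≤-reflexive (∣-∣-swap (seq (u j) m) (diag j)))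
          (diag-error j m (1/≤ j ≤j) (⊔ʳ {M ℕ.⊔ at i} ℕ.≤-refl))))
      (ℚ.≤-trans (p≤p+q (ℚ.<⇒≤ (quarter-pos 0<δ))) (ℚ.≤-reflexive (quarters δ)))
      where
      M = proj₁ (close i j ≤i ≤j)
      m = (M ℕ.⊔ at i) ℕ.⊔ at j

    diag-near : ∀ i → late ℕ.≤ i → ∀ n → late ℕ.⊔ at i ℕ.≤ n →
      ℚ.∣ seq (u i) n ℚ.- diag n ∣ ℚ.≤ e ℚ.+ e ℚ.+ e
    diag-near i ≤i n ≤n =
      triangle₃ {seq (u i) n} {seq (u i) m} {seq (u n) m} {diag n}
        (ℚ.≤-trans (proj₂ (cauchy (u i) (1/suc i) (1/suc-pos i)) n m (⊔ʳ {late} ≤n)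
          (⊔ʳ {M} (⊔ˡ {M ℕ.⊔ at i} ℕ.≤-refl))) (1/≤ i ≤i))
        (proj₂ (close i n ≤i (⊔ˡ ≤n)) m (⊔ˡ (⊔ˡ {M ℕ.⊔ at i} ℕ.≤-refl)))
        (ℚ.≤-trans (ℚ.≤-reflexive (∣-∣-swap (seq (u n) m) (diag n)))
          (diag-error n m (1/≤ n (⊔ˡ ≤n)) (⊔ʳ {M ℕ.⊔ at i} ℕ.≤-refl)))
      where
      M = proj₁ (close i n ≤i (⊔ˡ ≤n))
      m = (M ℕ.⊔ at i) ℕ.⊔ at n

  L : ℝ
  seq    L = diag
  cauchy L δ 0<δ = late δ 0<δ , diag-cauchy δ 0<δ

  L-limit : u ⟶ L
  L-limit ε (mk< δ 0<δ M δ≤) = late δ 0<δ , λ i ≤i →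
    mk< (quarter δ) (quarter-pos 0<δ) (M ℕ.⊔ (late δ 0<δ ℕ.⊔ at i)) λ n ≤n →
      ℚ.≤-trans (ℚ.+-monoˡ-≤ (quarter δ) (diag-near δ 0<δ i ≤i n (⊔ʳ {M} ≤n)))
        (ℚ.≤-trans (ℚ.≤-reflexive (quarters δ))
          (ℚ.≤-trans (ℚ.≤-reflexive (sym (ℚ.+-identityˡ δ))) (δ≤ n (⊔ˡ ≤n))))

------------------------------------------------------------------------
-- The alternating Hurwitz zeta function

-- ζE s x = Σ_{n ≥ 0} (-1)ⁿ / (n + x)ˢ for positive integers s and positive real x.
-- For such s the complex power is the integer power, and the series converges
-- (conditionally when s = 1) by the alternating series test; ζE-sum records that
-- ζE is its sum.
ζE-term : (s : ℕ) (x : ℝ) {{_ : 0ℝ < x}} → ℕ → ℝ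
ζE-term s x n = (- 1ℝ) ^ n / (fromℕ n + x) ^ s

sgn : ℕ → ℚ
sgn n = (ℚ.- 1ℚ) ℚPow.^ n

∣sgn∣ : ∀ n → ℚ.∣ sgn n ∣ ≡ 1ℚ
∣sgn∣ zero    = refl
∣sgn∣ (suc n) = trans (ℚ.∣p*q∣≡∣p∣*∣q∣ (ℚ.- 1ℚ) (sgn n)) (cong (1ℚ ℚ.*_) (∣sgn∣ n))

-- b m - b (m + 1) + ⋯ ± b (m + l - 1)
alt : (ℕ → ℚ) → ℕ → ℕ → ℚ
alt b m zero    = 0ℚ
alt b m (suc l) = b m ℚ.- alt b (suc m) l

alternating-bounds : ∀ b → (∀ n → 0ℚ ℚ.≤ b n) → (∀ n → b (suc n) ℚ.≤ b n) →
  ∀ m l → 0ℚ ℚ.≤ alt b m l × alt b m l ℚ.≤ b m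
alternating-bounds b 0≤ ↘ m zero = ℚ.≤-refl , 0≤ m
alternating-bounds b 0≤ ↘ m (suc l) with alternating-bounds b 0≤ ↘ (suc m) l
... | lo , hi =
  subst (ℚ._≤ b m ℚ.- t) (ℚ.+-inverseʳ t) (ℚ.+-monoˡ-≤ (ℚ.- t) (ℚ.≤-trans hi (↘ m))) ,
  subst (b m ℚ.- t ℚ.≤_) (ℚ.+-identityʳ (b m)) (ℚ.+-monoʳ-≤ (b m) (ℚ.neg-antimono-≤ lo))
  where t = alt b (suc m) l

∑ℚ : ℕ → (ℕ → ℚ) → ℚ
∑ℚ zero    f = 0ℚ
∑ℚ (suc n) f = ∑ℚ n f ℚ.+ f n

seq-∑ : ∀ n f j → seq (∑ n f) j ≡ ∑ℚ n (λ i → seq (f i) j)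
seq-∑ zero    f j = refl
seq-∑ (suc n) f j = cong (ℚ._+ seq (f n) j) (seq-∑ n f j)

∑ℚ-tail : ∀ b m l → ∑ℚ (l ℕ.+ m) (λ i → sgn i ℚ.* b i) ℚ.- ∑ℚ m (λ i → sgn i ℚ.* b i) ≡ sgn m ℚ.* alt b m l
∑ℚ-tail b m zero = trans (ℚ.+-inverseʳ (∑ℚ m (λ i → sgn i ℚ.* b i))) (sym (ℚ.*-zeroʳ (sgn m)))
∑ℚ-tail b m (suc l) = trans
  (solve 3 (λ a c d → a :- c := (a :- (c :+ d)) :+ d) refl
    (∑ℚ (suc l ℕ.+ m) f) (∑ℚ m f) (f m))
  (trans (cong (ℚ._+ f m) (trans
      (cong (λ k → ∑ℚ k f ℚ.- ∑ℚ (suc m) f) (sym (ℕ.+-suc l m)))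
      (∑ℚ-tail b (suc m) l)))
    (solve 3 (λ g t y → ((:- con 1ℚ) :* g) :* t :+ g :* y := g :* (y :- t)) refl
      (sgn m) (alt b (suc m) l) (b m)))
  where
  f : ℕ → ℚ
  f i = sgn i ℚ.* b i

∣tail∣≤ : ∀ b → (∀ n → 0ℚ ℚ.≤ b n) → (∀ n → b (suc n) ℚ.≤ b n) → ∀ m n → m ℕ.≤ n →
  ℚ.∣ ∑ℚ n (λ i → sgn i ℚ.* b i) ℚ.- ∑ℚ m (λ i → sgn i ℚ.* b i) ∣ ℚ.≤ b m
∣tail∣≤ b 0≤ ↘ m n m≤n = begin
  ℚ.∣ S n ℚ.- S m ∣                      ≡⟨ cong (λ k → ℚ.∣ S k ℚ.- S m ∣) (sym (ℕ.m∸n+n≡m m≤n)) ⟩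
  ℚ.∣ S (n ℕ.∸ m ℕ.+ m) ℚ.- S m ∣        ≡⟨ cong ℚ.∣_∣ (∑ℚ-tail b m (n ℕ.∸ m)) ⟩
  ℚ.∣ sgn m ℚ.* t ∣                      ≡⟨ ℚ.∣p*q∣≡∣p∣*∣q∣ (sgn m) t ⟩
  ℚ.∣ sgn m ∣ ℚ.* ℚ.∣ t ∣                ≡⟨ cong₂ ℚ._*_ (∣sgn∣ m) (ℚ.0≤p⇒∣p∣≡p (proj₁ 0≤t≤)) ⟩
  1ℚ ℚ.* t                               ≡⟨ ℚ.*-identityˡ t ⟩
  t                                      ≤⟨ proj₂ 0≤t≤ ⟩
  b m                                    ∎
  where
  open ℚ.≤-Reasoning
  S : ℕ → ℚ
  S k = ∑ℚ k (λ i → sgn i ℚ.* b i)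
  t : ℚ
  t = alt b m (n ℕ.∸ m)
  0≤t≤ : 0ℚ ℚ.≤ t × t ℚ.≤ b m
  0≤t≤ = alternating-bounds b 0≤ ↘ m (n ℕ.∸ m)

-- If 1 ≤ c p then 1/p ≤ c.
recip≤ : ∀ {c p} → 0ℚ ℚ.< p → 1ℚ ℚ.≤ c ℚ.* p → recip p ℚ.≤ c
recip≤ {c} {p} 0<p 1≤cp = begin
  recip p               ≡⟨ ℚ.*-identityˡ (recip p) ⟨
  1ℚ ℚ.* recip p        ≤⟨ ℚ.*-monoʳ-≤-nonNeg (recip p) {{ℚ.nonNegative (ℚ.<⇒≤ (recip-pos 0<p))}} 1≤cp ⟩
  c ℚ.* p ℚ.* recip p   ≡⟨ solve 3 (λ c p r → c :* p :* r := c :* (r :* p)) refl c p (recip p) ⟩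
  c ℚ.* (recip p ℚ.* p) ≡⟨ cong (c ℚ.*_) (recip-* 0<p) ⟩
  c ℚ.* 1ℚ              ≡⟨ ℚ.*-identityʳ c ⟩
  c                     ∎
  where open ℚ.≤-Reasoning

recip-anti : ∀ {p q} → 0ℚ ℚ.< p → p ℚ.≤ q → recip q ℚ.≤ recip p
recip-anti {p} {q} 0<p p≤q = recip≤ (ℚ.<-≤-trans 0<p p≤q)
  (ℚ.≤-trans (ℚ.≤-reflexive (sym (recip-* 0<p)))
    (ℚ.*-monoˡ-≤-nonNeg (recip p) {{ℚ.nonNegative (ℚ.<⇒≤ (recip-pos 0<p))}} p≤q))

ι : ℕ → ℚ
ι n = + n ℚ./ 1

toℚᵘ-ι : ∀ n → ℚ.toℚᵘ (ι n) ℚᵘ.≃ ℚᵘ.mkℚᵘ (+ n) 0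
toℚᵘ-ι n = ℚ.toℚᵘ-fromℚᵘ (ℚᵘ.mkℚᵘ (+ n) 0)

ι-mono : ∀ {m n} → m ℕ.≤ n → ι m ℚ.≤ ι n
ι-mono {m} {n} m≤n = ℚ.toℚᵘ-cancel-≤ (ℚᵘ.≤-trans (ℚᵘ.≤-reflexive (toℚᵘ-ι m))
  (ℚᵘ.≤-trans (ℚᵘ.*≤* (ℤ.*-monoʳ-≤-nonNeg (+ 1) (ℤ.+≤+ m≤n)))
    (ℚᵘ.≤-reflexive (ℚᵘ.≃-sym (toℚᵘ-ι n)))))

1/suc-* : ∀ n → 1/suc n ℚ.* ι (suc n) ≡ 1ℚ
1/suc-* n = ℚ.toℚᵘ-injective (ℚᵘ.≃-trans (ℚ.toℚᵘ-homo-* (1/suc n) (ι (suc n)))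
  (ℚᵘ.≃-trans (ℚᵘ.*-cong (ℚ.toℚᵘ-fromℚᵘ (ℚᵘ.mkℚᵘ (+ 1) n)) (toℚᵘ-ι (suc n)))
    (ℚᵘ.*≡* (trans (ℤ.*-identityʳ (+ 1 ℤ.* + suc n))
      (cong (λ k → + 1 ℤ.* (+ k)) (sym (ℕ.*-identityʳ (suc n))))))))

^-pos : ∀ {p} n → 0ℚ ℚ.< p → 0ℚ ℚ.< p ℚPow.^ n
^-pos zero    0<p = 0<1
^-pos (suc n) 0<p = *-pos 0<p (^-pos n 0<p)

^-mono-≤ : ∀ {p q} n → 0ℚ ℚ.< p → p ℚ.≤ q → p ℚPow.^ n ℚ.≤ q ℚPow.^ n
^-mono-≤ zero    0<p p≤q = ℚ.≤-refl
^-mono-≤ (suc n) 0<p p≤q = *-mono-≤ (ℚ.<⇒≤ (^-pos n 0<p))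
  (ℚ.≤-trans (ℚ.<⇒≤ 0<p) p≤q) p≤q (^-mono-≤ n 0<p p≤q)

1≤^ : ∀ {p} n → 1ℚ ℚ.≤ p → 1ℚ ℚ.≤ p ℚPow.^ n
1≤^ zero    1≤p = ℚ.≤-refl
1≤^ (suc n) 1≤p = *-mono-≤ {1ℚ} (ℚ.<⇒≤ 0<1) (ℚ.≤-trans (ℚ.<⇒≤ 0<1) 1≤p) 1≤p (1≤^ n 1≤p)

p≤^suc : ∀ {p} n → 1ℚ ℚ.≤ p → p ℚ.≤ p ℚPow.^ suc n
p≤^suc {p} n 1≤p = ℚ.≤-trans (ℚ.≤-reflexive (sym (ℚ.*-identityʳ p)))
  (ℚ.*-monoˡ-≤-nonNeg p {{ℚ.nonNegative (ℚ.≤-trans (ℚ.<⇒≤ 0<1) 1≤p)}} (1≤^ n 1≤p))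

ζE-cauchy : ∀ s {{_ : NonZero s}} x {{_ : 0ℝ < x}} → Cauchy (λ n → ∑[ i < n ] ζE-term s x i)
ζE-cauchy (suc s) x {{x>0}} ε (mk< δ 0<δ M δ≤) =
  suc N , λ m n N≤m N≤n → mk< (½ ℚ.* δ) (½-pos 0<δ) (M ℕ.⊔ J) λ j ≤j →
    ℚ.≤-trans (ℚ.+-monoˡ-≤ (½ ℚ.* δ) (close m n N≤m N≤n j (⊔ʳ {M} ≤j)))
      (ℚ.≤-trans (ℚ.≤-reflexive (½+½ δ))
        (ℚ.≤-trans (ℚ.≤-reflexive (sym (ℚ.+-identityˡ δ))) (δ≤ j (⊔ˡ ≤j))))
  where
  open _<_ x>0 renaming (gap to η; 0<gap to 0<η; from to J; gap≤ to η≤)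

  small : ∃[ N ] ∀ n → N ℕ.≤ n → 1/suc n ℚ.≤ ½ ℚ.* δ
  small = archimedean (½ ℚ.* δ) (½-pos 0<δ)

  N : ℕ
  N = proj₁ small

  b : ℕ → ℕ → ℚ
  b j n = recip ((ι n ℚ.+ seq x j) ℚPow.^ suc s)

  S : ℕ → ℕ → ℚ
  S j n = ∑ℚ n (λ i → sgn i ℚ.* b j i)

  module _ (j : ℕ) (J≤j : J ℕ.≤ j) where
    0<x : 0ℚ ℚ.< seq x j
    0<x = ℚ.<-≤-trans 0<η (ℚ.≤-trans (ℚ.≤-reflexive (sym (ℚ.+-identityˡ η))) (η≤ j J≤j))

    0<n+x : ∀ n → 0ℚ ℚ.< ι n ℚ.+ seq x j
    0<n+x n = ℚ.<-≤-trans 0<x (p≤q+p (ℚ.nonNegative⁻¹ (ι n) {{ℚ.normalize-nonNeg n 1}}))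

    b≥0 : ∀ n → 0ℚ ℚ.≤ b j n
    b≥0 n = ℚ.<⇒≤ (recip-pos (^-pos (suc s) (0<n+x n)))

    b↘ : ∀ n → b j (suc n) ℚ.≤ b j n
    b↘ n = recip-anti (^-pos (suc s) (0<n+x n))
      (^-mono-≤ (suc s) (0<n+x n) (ℚ.+-monoˡ-≤ (seq x j) (ι-mono (ℕ.n≤1+n n))))

    b≤ : ∀ n → b j (suc n) ℚ.≤ 1/suc n
    b≤ n = recip≤ (^-pos (suc s) (0<n+x (suc n)))
      (ℚ.≤-trans (ℚ.≤-reflexive (sym (1/suc-* n)))
        (ℚ.*-monoˡ-≤-nonNeg (1/suc n) {{ℚ.nonNegative (ℚ.<⇒≤ (1/suc-pos n))}}
          (ℚ.≤-trans ι≤ (p≤^suc s (ℚ.≤-trans (ι-mono {1} {suc n} (s≤s z≤n)) ι≤)))))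
      where
      ι≤ : ι (suc n) ℚ.≤ ι (suc n) ℚ.+ seq x j
      ι≤ = p≤p+q (ℚ.<⇒≤ 0<x)

    ordered : ∀ m n → suc N ℕ.≤ m → m ℕ.≤ n → ℚ.∣ S j n ℚ.- S j m ∣ ℚ.≤ ½ ℚ.* δ
    ordered (suc m) n (s≤s N≤m) m≤n = ℚ.≤-trans (∣tail∣≤ (b j) b≥0 b↘ (suc m) n m≤n)
      (ℚ.≤-trans (b≤ m) (proj₂ small m N≤m))

  close : ∀ m n → suc N ℕ.≤ m → suc N ℕ.≤ n → ∀ j → J ℕ.≤ j →
    ℚ.∣ seq (∑ m (ζE-term (suc s) x)) j ℚ.- seq (∑ n (ζE-term (suc s) x)) j ∣ ℚ.≤ ½ ℚ.* δ
  close m n N≤m N≤n j J≤j = subst (ℚ._≤ ½ ℚ.* δ)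
    (cong ℚ.∣_∣ (sym (cong₂ ℚ._-_ (seq-∑ m (ζE-term (suc s) x) j) (seq-∑ n (ζE-term (suc s) x) j))))
    (either (ℕ.≤-total m n))
    where
    either : m ℕ.≤ n ⊎ n ℕ.≤ m → ℚ.∣ S j m ℚ.- S j n ∣ ℚ.≤ ½ ℚ.* δ
    either (inj₁ m≤n) = ℚ.≤-trans (ℚ.≤-reflexive (∣-∣-swap (S j m) (S j n))) (ordered j J≤j m n N≤m m≤n)
    either (inj₂ n≤m) = ordered j J≤j n m N≤n n≤m

ζE : (s : ℕ) {{_ : NonZero s}} (x : ℝ) {{_ : 0ℝ < x}} → ℝ
ζE s x = proj₁ (complete (λ n → ∑[ i < n ] ζE-term s x i) (ζE-cauchy s x))

ζE-sum : ∀ s {{_ : NonZero s}} x {{_ : 0ℝ < x}} → ζE-term s x sumsTo ζE s x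
ζE-sum s x = proj₂ (complete (λ n → ∑[ i < n ] ζE-term s x i) (ζE-cauchy s x))

2kp≢0 : ∀ k p {{_ : NonZero k}} {{_ : NonZero p}} → NonZero (2 ℕ.* k ℕ.* p)
2kp≢0 k p = ℕ.m*n≢0 (2 ℕ.* k) p {{ℕ.m*n≢0 2 k}}

{-# OPTIONS --safe #-}
module Submission where

-- Write yₙ = (n + a)²ᵏ and F(n , i) = (-1)ⁿ⁺ⁱ yₙ^-(2q+2) · yₙ / (yₙ + yᵢ). The geometric sum formula
-- turns F(n , i) + F(i , n) into a combination of products yₙ^-(j+1) yᵢ^-(2q-j+1), so the sum of F
-- over the square n, i < N is exactly half the alternating sum of products of partial sums of ζE.
-- Replacing the inner sums over i < N by their limits costs at most yₙ / y_N each by the alternating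
-- series bound; after weighting and summing over n < N this is O(N · y_N⁻¹) = O(1/N).
-- All estimates are made on rational approximations, for indices past which these are bounded
-- away from 0.

open import Defs
open import Algebra.Bundles using (CommutativeRing)
open import Data.Nat as ℕ using (ℕ; zero; suc; NonZero; _∸_; z≤n; s≤s)
import Data.Nat.Properties as ℕ
open import Data.Nat.Solver using () renaming (module +-*-Solver to ℕ-Solver)
import Data.Integer as ℤ
import Data.Integer.Properties as ℤ
open import Data.Rational as ℚ using (ℚ; 0ℚ; 1ℚ; ½)
import Data.Rational.Properties as ℚ
open import Data.Rational.Solver using (module +-*-Solver)
import Data.Rational.Unnormalised as ℚᵘ
import Data.Rational.Unnormalised.Properties as ℚᵘ
open import Data.Product using (∃-syntax; Σ-syntax; _×_; _,_; proj₁; proj₂)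
open import Data.Sum using (inj₁; inj₂)
open import Function using (_∘_)
open import Relation.Binary.PropositionalEquality
  using (_≡_; refl; sym; trans; cong; cong₂; subst; subst₂; module ≡-Reasoning)
open import Algebra.Properties.Semiring.Exp (CommutativeRing.semiring ℚ.+-*-commutativeRing)
  using (^-assocʳ)
open +-*-Solver using (solve; _:=_; _:+_; _:*_; :-_; _:-_; con)
open ℚPow using () renaming (_^_ to _^ℚ_)

-- Finite sums of rationals

∑ℚ-cong : ∀ n {f g : ℕ → ℚ} → (∀ i → i ℕ.< n → f i ≡ g i) → ∑ℚ n f ≡ ∑ℚ n g
∑ℚ-cong zero    f≗g = refl
∑ℚ-cong (suc n) f≗g = cong₂ ℚ._+_ (∑ℚ-cong n (λ i i<n → f≗g i (ℕ.m≤n⇒m≤1+n i<n))) (f≗g n ℕ.≤-refl)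

∑ℚ-0 : ∀ n → ∑ℚ n (λ _ → 0ℚ) ≡ 0ℚ
∑ℚ-0 zero    = refl
∑ℚ-0 (suc n) = trans (ℚ.+-identityʳ _) (∑ℚ-0 n)

∑ℚ-+ : ∀ n f g → ∑ℚ n (λ i → f i ℚ.+ g i) ≡ ∑ℚ n f ℚ.+ ∑ℚ n g
∑ℚ-+ zero    f g = refl
∑ℚ-+ (suc n) f g = trans (cong (ℚ._+ (f n ℚ.+ g n)) (∑ℚ-+ n f g))
  (solve 4 (λ a b c d → (a :+ b) :+ (c :+ d) := (a :+ c) :+ (b :+ d)) refl (∑ℚ n f) (∑ℚ n g) (f n) (g n))

∑ℚ-*ˡ : ∀ n c f → c ℚ.* ∑ℚ n f ≡ ∑ℚ n (λ i → c ℚ.* f i)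
∑ℚ-*ˡ zero    c f = ℚ.*-zeroʳ c
∑ℚ-*ˡ (suc n) c f = trans (ℚ.*-distribˡ-+ c (∑ℚ n f) (f n)) (cong (ℚ._+ c ℚ.* f n) (∑ℚ-*ˡ n c f))

∑ℚ-*ʳ : ∀ n c f → ∑ℚ n f ℚ.* c ≡ ∑ℚ n (λ i → f i ℚ.* c)
∑ℚ-*ʳ n c f = trans (ℚ.*-comm (∑ℚ n f) c)
  (trans (∑ℚ-*ˡ n c f) (∑ℚ-cong n (λ i _ → ℚ.*-comm c (f i))))

∑ℚ-swap : ∀ m n (f : ℕ → ℕ → ℚ) → ∑ℚ m (λ i → ∑ℚ n (f i)) ≡ ∑ℚ n (λ j → ∑ℚ m (λ i → f i j))
∑ℚ-swap zero    n f = sym (∑ℚ-0 n)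
∑ℚ-swap (suc m) n f = trans (cong (ℚ._+ ∑ℚ n (f m)) (∑ℚ-swap m n f))
  (sym (∑ℚ-+ n (λ j → ∑ℚ m (λ i → f i j)) (f m)))

∑ℚ-*-∑ℚ : ∀ m n f g → ∑ℚ m f ℚ.* ∑ℚ n g ≡ ∑ℚ m (λ i → ∑ℚ n (λ j → f i ℚ.* g j))
∑ℚ-*-∑ℚ m n f g = trans (∑ℚ-*ʳ m (∑ℚ n g) f) (∑ℚ-cong m (λ i _ → ∑ℚ-*ˡ n (f i) g))

-- Transposing the square of indices leaves the sum unchanged, so the sum is the average of itself
-- and its transpose.
∑ℚ-symmetrise : ∀ n (f : ℕ → ℕ → ℚ) →
  ∑ℚ n (λ i → ∑ℚ n (f i)) ≡ ½ ℚ.* ∑ℚ n (λ i → ∑ℚ n (λ j → f i j ℚ.+ f j i))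
∑ℚ-symmetrise n f = begin
  S                                                              ≡⟨ ½+½ S ⟨
  ½ ℚ.* S ℚ.+ ½ ℚ.* S                                            ≡⟨ ℚ.*-distribˡ-+ ½ S S ⟨
  ½ ℚ.* (S ℚ.+ S)                                                ≡⟨ cong (λ t → ½ ℚ.* (S ℚ.+ t)) (∑ℚ-swap n n f) ⟩
  ½ ℚ.* (S ℚ.+ ∑ℚ n (λ i → ∑ℚ n (λ j → f j i)))                  ≡⟨ cong (½ ℚ.*_) (∑ℚ-+ n _ _) ⟨
  ½ ℚ.* ∑ℚ n (λ i → ∑ℚ n (f i) ℚ.+ ∑ℚ n (λ j → f j i))           ≡⟨ cong (½ ℚ.*_) (∑ℚ-cong n (λ i _ → sym (∑ℚ-+ n _ _))) ⟩
  ½ ℚ.* ∑ℚ n (λ i → ∑ℚ n (λ j → f i j ℚ.+ f j i))                ∎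
  where
  open ≡-Reasoning
  S : ℚ
  S = ∑ℚ n (λ i → ∑ℚ n (f i))

-- Powers and reciprocals

recip-unique : ∀ {p r} → 0ℚ ℚ.< p → r ℚ.* p ≡ 1ℚ → recip p ≡ r
recip-unique {p} {r} 0<p rp≡1 = begin
  recip p                ≡⟨ ℚ.*-identityˡ (recip p) ⟨
  1ℚ ℚ.* recip p         ≡⟨ cong (ℚ._* recip p) rp≡1 ⟨
  r ℚ.* p ℚ.* recip p    ≡⟨ solve 3 (λ r p t → r :* p :* t := r :* (t :* p)) refl r p (recip p) ⟩
  r ℚ.* (recip p ℚ.* p)  ≡⟨ cong (r ℚ.*_) (recip-* 0<p) ⟩
  r ℚ.* 1ℚ               ≡⟨ ℚ.*-identityʳ r ⟩
  r                      ∎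
  where open ≡-Reasoning

recip-^ : ∀ {p} n → 0ℚ ℚ.< p → recip (p ^ℚ n) ≡ recip p ^ℚ n
recip-^ {p} n 0<p = recip-unique (^-pos n 0<p) (inverse n)
  where
  open ≡-Reasoning
  inverse : ∀ n → recip p ^ℚ n ℚ.* p ^ℚ n ≡ 1ℚ
  inverse zero    = refl
  inverse (suc n) = begin
    recip p ℚ.* recip p ^ℚ n ℚ.* (p ℚ.* p ^ℚ n)
      ≡⟨ solve 4 (λ r s p t → r :* s :* (p :* t) := r :* p :* (s :* t)) refl (recip p) (recip p ^ℚ n) p (p ^ℚ n) ⟩
    recip p ℚ.* p ℚ.* (recip p ^ℚ n ℚ.* p ^ℚ n)
      ≡⟨ cong₂ ℚ._*_ (recip-* 0<p) (inverse n) ⟩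
    1ℚ ∎

recip-^-* : ∀ {p} m n → 0ℚ ℚ.< p → recip (p ^ℚ (m ℕ.* n)) ≡ recip (p ^ℚ m) ^ℚ n
recip-^-* {p} m n 0<p = trans (cong recip (sym (^-assocʳ p m n))) (recip-^ n (^-pos m 0<p))

sgn-even : ∀ n → sgn (2 ℕ.* n) ≡ 1ℚ
sgn-even zero    = refl
sgn-even (suc n) = begin
  sgn (2 ℕ.* suc n)                        ≡⟨ cong (sgn ∘ suc) (ℕ.+-suc n (n ℕ.+ 0)) ⟩
  ℚ.- 1ℚ ℚ.* (ℚ.- 1ℚ ℚ.* sgn (2 ℕ.* n))    ≡⟨ cong (λ t → ℚ.- 1ℚ ℚ.* (ℚ.- 1ℚ ℚ.* t)) (sgn-even n) ⟩
  1ℚ                                       ∎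
  where open ≡-Reasoning

-- With p = j + 1, this identifies the theorem's sign (-1)^(p+1) with the (-1)^j of the kernel.
sgn-2+ : ∀ j → sgn (suc j ℕ.+ 1) ≡ sgn j
sgn-2+ j = trans (cong (sgn ∘ suc) (ℕ.+-comm j 1))
  (solve 1 (λ s → (:- con 1ℚ) :* ((:- con 1ℚ) :* s) := s) refl (sgn j))

-- The symmetrised kernel

-- This is u v (vⁿ - (-u)ⁿ) / (v + u), a geometric sum of ratio -u/v, expanded so that each monomial
-- separates u from v.
kernel : ℕ → ℚ → ℚ → ℚ
kernel n u v = ∑ℚ n (λ j → sgn j ℚ.* (u ^ℚ suc j ℚ.* v ^ℚ (n ∸ j)))

kernel-suc : ∀ n u v → kernel (suc n) u v ≡ v ℚ.* kernel n u v ℚ.+ sgn n ℚ.* (u ^ℚ suc n ℚ.* v)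
kernel-suc n u v = cong₂ ℚ._+_
  (trans (∑ℚ-cong n (λ j j<n → trans
      -- `suc n ∸ j` equals `suc (n ∸ j)` only because j ≤ n; the new successor supplies the factor
      -- v.
      (cong (λ e → sgn j ℚ.* (u ^ℚ suc j ℚ.* v ^ℚ e)) (ℕ.+-∸-assoc 1 (ℕ.<⇒≤ j<n)))
      (solve 4 (λ s a v b → s :* (a :* (v :* b)) := v :* (s :* (a :* b))) refl
        (sgn j) (u ^ℚ suc j) v (v ^ℚ (n ∸ j)))))
    (sym (∑ℚ-*ˡ n v _)))
  (cong (λ t → sgn n ℚ.* (u ^ℚ suc n ℚ.* t))
    (trans (cong (v ^ℚ_) (ℕ.m+n∸n≡m 1 n)) (ℚ.*-identityʳ v)))

-- Induction on n by `kernel-suc`: the v-part of (u + v) times the last monomial cancels the (-u)ⁿ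
-- left over from the previous stage, as in a telescoping sum.
kernel-* : ∀ n u v → (u ℚ.+ v) ℚ.* kernel n u v ≡ u ℚ.* v ℚ.* (v ^ℚ n ℚ.- sgn n ℚ.* u ^ℚ n)
kernel-* zero    u v = solve 2 (λ u v → (u :+ v) :* con 0ℚ := u :* v :* (con 1ℚ :- con 1ℚ :* con 1ℚ)) refl u v
kernel-* (suc n) u v = begin
  (u ℚ.+ v) ℚ.* kernel (suc n) u v
    ≡⟨ cong ((u ℚ.+ v) ℚ.*_) (kernel-suc n u v) ⟩
  (u ℚ.+ v) ℚ.* (v ℚ.* kernel n u v ℚ.+ s ℚ.* (u ℚ.* p ℚ.* v))
    ≡⟨ solve 5 (λ u v h s p → (u :+ v) :* (v :* h :+ s :* (u :* p :* v))
                           := v :* ((u :+ v) :* h) :+ (u :+ v) :* (s :* (u :* p :* v)))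
         refl u v (kernel n u v) s p ⟩
  v ℚ.* ((u ℚ.+ v) ℚ.* kernel n u v) ℚ.+ (u ℚ.+ v) ℚ.* (s ℚ.* (u ℚ.* p ℚ.* v))
    ≡⟨ cong (λ t → v ℚ.* t ℚ.+ (u ℚ.+ v) ℚ.* (s ℚ.* (u ℚ.* p ℚ.* v))) (kernel-* n u v) ⟩
  v ℚ.* (u ℚ.* v ℚ.* (r ℚ.- s ℚ.* p)) ℚ.+ (u ℚ.+ v) ℚ.* (s ℚ.* (u ℚ.* p ℚ.* v))
    ≡⟨ solve 5 (λ u v s p r → v :* (u :* v :* (r :- s :* p)) :+ (u :+ v) :* (s :* (u :* p :* v))
                           := u :* v :* (v :* r :- ((:- con 1ℚ) :* s) :* (u :* p)))
         refl u v s p r ⟩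
  u ℚ.* v ℚ.* (v ^ℚ suc n ℚ.- sgn (suc n) ℚ.* u ^ℚ suc n) ∎
  where
  open ≡-Reasoning
  s p r : ℚ
  s = sgn n
  p = u ^ℚ n
  r = v ^ℚ n

-- Put u = 1/y and v = 1/z. Cancelling one power of u against y and one of v against z turns the
-- left side into (uⁿ + vⁿ) / (y + z). Since n is odd, `kernel-*` gives the same value for the
-- kernel.
kernel-symmetrised : ∀ q {y z} → 0ℚ ℚ.< y → 0ℚ ℚ.< z →
  let n = suc (2 ℕ.* q) in
  recip y ^ℚ suc n ℚ.* (y ℚ.* recip (y ℚ.+ z)) ℚ.+ recip z ^ℚ suc n ℚ.* (z ℚ.* recip (z ℚ.+ y))
    ≡ kernel n (recip y) (recip z)
kernel-symmetrised q {y} {z} 0<y 0<z = begin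
  u ℚ.* u ^ℚ n ℚ.* (y ℚ.* r) ℚ.+ v ℚ.* v ^ℚ n ℚ.* (z ℚ.* recip (z ℚ.+ y))
    ≡⟨ cong (λ t → u ℚ.* u ^ℚ n ℚ.* (y ℚ.* r) ℚ.+ v ℚ.* v ^ℚ n ℚ.* (z ℚ.* recip t)) (ℚ.+-comm z y) ⟩
  u ℚ.* u ^ℚ n ℚ.* (y ℚ.* r) ℚ.+ v ℚ.* v ^ℚ n ℚ.* (z ℚ.* r)
    ≡⟨ solve 7 (λ u p y r v q z → u :* p :* (y :* r) :+ v :* q :* (z :* r)
                               := r :* (p :* (u :* y) :+ q :* (v :* z)))
         refl u (u ^ℚ n) y r v (v ^ℚ n) z ⟩
  r ℚ.* (u ^ℚ n ℚ.* (u ℚ.* y) ℚ.+ v ^ℚ n ℚ.* (v ℚ.* z))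
    ≡⟨ cong₂ (λ s t → r ℚ.* (u ^ℚ n ℚ.* s ℚ.+ v ^ℚ n ℚ.* t)) uy vz ⟩
  r ℚ.* (u ^ℚ n ℚ.* 1ℚ ℚ.+ v ^ℚ n ℚ.* 1ℚ)
    ≡⟨ cong (r ℚ.*_) numerator ⟩
  r ℚ.* ((y ℚ.+ z) ℚ.* kernel n u v)
    ≡⟨ trans (sym (ℚ.*-assoc r (y ℚ.+ z) (kernel n u v))) (cong (ℚ._* kernel n u v) (recip-* (+-pos 0<y 0<z))) ⟩
  1ℚ ℚ.* kernel n u v
    ≡⟨ ℚ.*-identityˡ (kernel n u v) ⟩
  kernel n u v ∎
  where
  open ≡-Reasoning
  n : ℕ
  n = suc (2 ℕ.* q)
  u v r : ℚ
  u = recip y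
  v = recip z
  r = recip (y ℚ.+ z)
  uy : u ℚ.* y ≡ 1ℚ
  uy = recip-* 0<y
  vz : v ℚ.* z ≡ 1ℚ
  vz = recip-* 0<z
  numerator : u ^ℚ n ℚ.* 1ℚ ℚ.+ v ^ℚ n ℚ.* 1ℚ ≡ (y ℚ.+ z) ℚ.* kernel n u v
  numerator = sym (begin
    (y ℚ.+ z) ℚ.* kernel n u v
      ≡⟨ solve 3 (λ y z h → (y :+ z) :* h := (con 1ℚ :* y :+ con 1ℚ :* z) :* h) refl y z (kernel n u v) ⟩
    (1ℚ ℚ.* y ℚ.+ 1ℚ ℚ.* z) ℚ.* kernel n u v
      -- Writing the units as v z and u y turns y + z into y z (u + v), whose second factor is the
      -- one in `kernel-*`.
      ≡⟨ cong₂ (λ s t → (s ℚ.* y ℚ.+ t ℚ.* z) ℚ.* kernel n u v) vz uy ⟨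
    (v ℚ.* z ℚ.* y ℚ.+ u ℚ.* y ℚ.* z) ℚ.* kernel n u v
      ≡⟨ solve 5 (λ y z u v h → (v :* z :* y :+ u :* y :* z) :* h := y :* z :* ((u :+ v) :* h))
           refl y z u v (kernel n u v) ⟩
    y ℚ.* z ℚ.* ((u ℚ.+ v) ℚ.* kernel n u v)
      ≡⟨ cong (y ℚ.* z ℚ.*_) (kernel-* n u v) ⟩
    y ℚ.* z ℚ.* (u ℚ.* v ℚ.* (v ^ℚ n ℚ.- ℚ.- 1ℚ ℚ.* sgn (2 ℕ.* q) ℚ.* u ^ℚ n))
      -- The oddness of n enters here: its sign is -1, so the difference of powers becomes a sum.
      ≡⟨ cong (λ s → y ℚ.* z ℚ.* (u ℚ.* v ℚ.* (v ^ℚ n ℚ.- ℚ.- 1ℚ ℚ.* s ℚ.* u ^ℚ n))) (sgn-even q) ⟩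
    y ℚ.* z ℚ.* (u ℚ.* v ℚ.* (v ^ℚ n ℚ.- ℚ.- 1ℚ ℚ.* 1ℚ ℚ.* u ^ℚ n))
      ≡⟨ solve 6 (λ y z u v a b → y :* z :* (u :* v :* (b :- (:- con 1ℚ) :* con 1ℚ :* a))
                               := (u :* y) :* (v :* z) :* (a :* con 1ℚ :+ b :* con 1ℚ))
           refl y z u v (u ^ℚ n) (v ^ℚ n) ⟩
    (u ℚ.* y) ℚ.* (v ℚ.* z) ℚ.* (u ^ℚ n ℚ.* 1ℚ ℚ.+ v ^ℚ n ℚ.* 1ℚ)
      ≡⟨ cong₂ (λ s t → s ℚ.* t ℚ.* (u ^ℚ n ℚ.* 1ℚ ℚ.+ v ^ℚ n ℚ.* 1ℚ)) uy vz ⟩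
    1ℚ ℚ.* 1ℚ ℚ.* (u ^ℚ n ℚ.* 1ℚ ℚ.+ v ^ℚ n ℚ.* 1ℚ)
      ≡⟨ ℚ.*-identityˡ _ ⟩
    u ^ℚ n ℚ.* 1ℚ ℚ.+ v ^ℚ n ℚ.* 1ℚ ∎)

-- The weight s n · s i is symmetric, so symmetrising reduces the summand to the kernel. Each
-- monomial of the kernel is a function of n times a function of i, so its double sum factors.
square-sum : ∀ q N (s y : ℕ → ℚ) → (∀ n → 0ℚ ℚ.< y n) →
  ∑ℚ N (λ n → s n ℚ.* recip (y n) ^ℚ suc (suc (2 ℕ.* q))
               ℚ.* ∑ℚ N (λ i → s i ℚ.* y n ℚ.* recip (y n ℚ.+ y i)))
    ≡ ½ ℚ.* ∑ℚ (suc (2 ℕ.* q)) (λ j → sgn j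
               ℚ.* ∑ℚ N (λ n → s n ℚ.* recip (y n) ^ℚ suc j)
               ℚ.* ∑ℚ N (λ i → s i ℚ.* recip (y i) ^ℚ suc (2 ℕ.* q ∸ j)))
square-sum q N s y 0<y = begin
  ∑ℚ N (λ n → w n ℚ.* ∑ℚ N (λ i → s i ℚ.* y n ℚ.* r n i))
    ≡⟨ ∑ℚ-cong N (λ n _ → ∑ℚ-*ˡ N (w n) _) ⟩
  ∑ℚ N (λ n → ∑ℚ N (λ i → w n ℚ.* (s i ℚ.* y n ℚ.* r n i)))
    ≡⟨ ∑ℚ-symmetrise N _ ⟩
  ½ ℚ.* ∑ℚ N (λ n → ∑ℚ N (λ i → w n ℚ.* (s i ℚ.* y n ℚ.* r n i) ℚ.+ w i ℚ.* (s n ℚ.* y i ℚ.* r i n)))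
    ≡⟨ cong (½ ℚ.*_) (∑ℚ-cong N (λ n _ → ∑ℚ-cong N (λ i _ → expand n i))) ⟩
  ½ ℚ.* ∑ℚ N (λ n → ∑ℚ N (λ i → ∑ℚ m (λ j → sgn j ℚ.* f j n ℚ.* g j i)))
    ≡⟨ cong (½ ℚ.*_) (∑ℚ-cong N (λ n _ → ∑ℚ-swap N m _)) ⟩
  ½ ℚ.* ∑ℚ N (λ n → ∑ℚ m (λ j → ∑ℚ N (λ i → sgn j ℚ.* f j n ℚ.* g j i)))
    ≡⟨ cong (½ ℚ.*_) (∑ℚ-swap N m _) ⟩
  ½ ℚ.* ∑ℚ m (λ j → ∑ℚ N (λ n → ∑ℚ N (λ i → sgn j ℚ.* f j n ℚ.* g j i)))
    ≡⟨ cong (½ ℚ.*_) (∑ℚ-cong m (λ j _ → sym (trans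
         (cong (ℚ._* ∑ℚ N (g j)) (∑ℚ-*ˡ N (sgn j) (f j)))
         (∑ℚ-*-∑ℚ N N _ (g j))))) ⟩
  ½ ℚ.* ∑ℚ m (λ j → sgn j ℚ.* ∑ℚ N (f j) ℚ.* ∑ℚ N (g j)) ∎
  where
  open ≡-Reasoning
  m : ℕ
  m = suc (2 ℕ.* q)
  w : ℕ → ℚ
  w n = s n ℚ.* recip (y n) ^ℚ suc m
  r f g : ℕ → ℕ → ℚ
  r n i = recip (y n ℚ.+ y i)
  f j n = s n ℚ.* recip (y n) ^ℚ suc j
  g j i = s i ℚ.* recip (y i) ^ℚ suc (2 ℕ.* q ∸ j)
  expand : ∀ n i → w n ℚ.* (s i ℚ.* y n ℚ.* r n i) ℚ.+ w i ℚ.* (s n ℚ.* y i ℚ.* r i n)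
    ≡ ∑ℚ m (λ j → sgn j ℚ.* f j n ℚ.* g j i)
  expand n i = begin
    w n ℚ.* (s i ℚ.* y n ℚ.* r n i) ℚ.+ w i ℚ.* (s n ℚ.* y i ℚ.* r i n)
      ≡⟨ solve 8 (λ a b p c d e h k → a :* p :* (b :* c :* d) :+ b :* e :* (a :* h :* k)
                                   := a :* b :* (p :* (c :* d) :+ e :* (h :* k)))
           refl (s n) (s i) (recip (y n) ^ℚ suc m) (y n) (r n i) (recip (y i) ^ℚ suc m) (y i) (r i n) ⟩
    s n ℚ.* s i ℚ.* (recip (y n) ^ℚ suc m ℚ.* (y n ℚ.* r n i) ℚ.+ recip (y i) ^ℚ suc m ℚ.* (y i ℚ.* r i n))
      ≡⟨ cong (s n ℚ.* s i ℚ.*_) (kernel-symmetrised q (0<y n) (0<y i)) ⟩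
    s n ℚ.* s i ℚ.* kernel m (recip (y n)) (recip (y i))
      ≡⟨ ∑ℚ-*ˡ m (s n ℚ.* s i) _ ⟩
    ∑ℚ m (λ j → s n ℚ.* s i ℚ.* (sgn j ℚ.* (recip (y n) ^ℚ suc j ℚ.* recip (y i) ^ℚ (m ∸ j))))
      -- Matching on `s≤s` yields j ≤ 2q, which lets the truncated subtraction pass under the
      -- successor.
      ≡⟨ ∑ℚ-cong m (λ { j (s≤s j≤2q) → trans
           (cong (λ e → s n ℚ.* s i ℚ.* (sgn j ℚ.* (recip (y n) ^ℚ suc j ℚ.* recip (y i) ^ℚ e)))
             (ℕ.+-∸-assoc 1 j≤2q))
           (solve 5 (λ a b c d e → a :* b :* (c :* (d :* e)) := c :* (a :* d) :* (b :* e)) refl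
             (s n) (s i) (sgn j) (recip (y n) ^ℚ suc j) (recip (y i) ^ℚ suc (2 ℕ.* q ∸ j))) }) ⟩
    ∑ℚ m (λ j → sgn j ℚ.* f j n ℚ.* g j i) ∎

-- Eventual closeness of rational approximations

Eventually : (ℕ → Set) → Set
Eventually P = ∃[ J ] ∀ j → J ℕ.≤ j → P j

map₂ : ∀ {P Q R : ℕ → Set} → (∀ j → P j → Q j → R j) → Eventually P → Eventually Q → Eventually R
map₂ f (J , p) (K , q) = J ℕ.⊔ K , λ j ≤j → f j (p j (⊔ˡ ≤j)) (q j (⊔ʳ {J} ≤j))

map₁ : ∀ {P Q : ℕ → Set} → (∀ j → P j → Q j) → Eventually P → Eventually Q
map₁ f (J , p) = J , λ j J≤j → f j (p j J≤j)

both : ∀ {P Q : ℕ → Set} → Eventually P → Eventually Q → Eventually (λ j → P j × Q j)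
both = map₂ (λ _ → _,_)

-- A weak inequality with a rational tolerance, so that errors add and scale without carrying the
-- gap that `_<_` demands; `near-<` restores the gap.
Near : ℚ → ℝ → ℝ → Set
Near ε x y = Eventually (λ j → ℚ.∣ seq x j ℚ.- seq y j ∣ ℚ.≤ ε)

infix 4 _⇢_

_⇢_ : (ℕ → ℝ) → ℝ → Set
u ⇢ L = ∀ ε → 0ℚ ℚ.< ε → Eventually (λ n → Near ε (u n) L)

-- Half of the gap of 0 < ε pays for the distance, the other half becomes the gap of the conclusion.
near-< : ∀ {x y ε} (0<ε : 0ℝ < ε) → Near (½ ℚ.* _<_.gap 0<ε) x y → ∣ x - y ∣ < ε
near-< (mk< δ 0<δ M δ≤) (J , p) = mk< (½ ℚ.* δ) (½-pos 0<δ) (M ℕ.⊔ J) λ j ≤j →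
  ℚ.≤-trans (ℚ.+-monoˡ-≤ (½ ℚ.* δ) (p j (⊔ʳ {M} ≤j)))
    (ℚ.≤-trans (ℚ.≤-reflexive (trans (½+½ δ) (sym (ℚ.+-identityˡ δ)))) (δ≤ j (⊔ˡ ≤j)))

⇢⇒⟶ : ∀ {u L} → u ⇢ L → u ⟶ L
⇢⇒⟶ u⇢L ε 0<ε = map₁ (λ _ → near-< 0<ε) (u⇢L _ (½-pos (_<_.0<gap 0<ε)))

⟶⇒⇢ : ∀ {u L} → u ⟶ L → u ⇢ L
⟶⇒⇢ u⟶L ε 0<ε = map₁ (λ _ p → _<_.from p , drop-gap p) (u⟶L (fromℚ ε) (fromℚ-pos 0<ε))

-- By symmetry of the distance it is enough to treat m ≤ n, the case that alternating tail bounds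
-- cover.
near⇒Cauchy : ∀ {u} →
  (∀ ε → 0ℚ ℚ.< ε → ∃[ N ] ∀ m n → N ℕ.≤ m → m ℕ.≤ n → Near ε (u n) (u m)) → Cauchy u
near⇒Cauchy {u} c ε 0<ε with c _ (½-pos (_<_.0<gap 0<ε))
... | N , p = N , λ m n N≤m N≤n → near-< 0<ε (either m n N≤m N≤n (ℕ.≤-total m n))
  where
  either : ∀ m n → N ℕ.≤ m → N ℕ.≤ n → _ → Near _ (u m) (u n)
  either m n N≤m N≤n (inj₁ m≤n) = map₁ (λ j → ℚ.≤-trans (ℚ.≤-reflexive (∣-∣-swap (seq (u m) j) (seq (u n) j)))) (p m n N≤m m≤n)
  either m n N≤m N≤n (inj₂ n≤m) = p n m N≤n n≤m

-- Limit laws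

⇢-const : ∀ x → (λ _ → x) ⇢ x
⇢-const x ε 0<ε = 0 , λ _ _ → 0 , λ j _ →
  subst (ℚ._≤ ε) (cong ℚ.∣_∣ (sym (ℚ.+-inverseʳ (seq x j)))) (ℚ.<⇒≤ 0<ε)

⇢-near : ∀ {u v L} → (∀ ε → 0ℚ ℚ.< ε → Eventually (λ n → Near ε (v n) (u n))) → u ⇢ L → v ⇢ L
⇢-near {u} {v} {L} v~u u⇢L ε 0<ε =
  map₂ (λ n → map₂ λ j p q → ℚ.≤-trans (triangle (seq (v n) j) (seq (u n) j) (seq L j))
      (ℚ.≤-trans (ℚ.+-mono-≤ p q) (ℚ.≤-reflexive (½+½ ε))))
    (v~u _ (½-pos 0<ε)) (u⇢L _ (½-pos 0<ε))

⇢-+ : ∀ {u v K L} → u ⇢ K → v ⇢ L → (λ n → u n + v n) ⇢ K + L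
⇢-+ {u} {v} {K} {L} u⇢K v⇢L ε 0<ε =
  map₂ (λ n → map₂ λ j p q → ℚ.≤-trans
      (ℚ.≤-reflexive (cong ℚ.∣_∣
        (solve 4 (λ a b c d → (a :+ b) :- (c :+ d) := (a :- c) :+ (b :- d)) refl
          (seq (u n) j) (seq (v n) j) (seq K j) (seq L j))))
      (ℚ.≤-trans (ℚ.∣p+q∣≤∣p∣+∣q∣ (seq (u n) j ℚ.- seq K j) (seq (v n) j ℚ.- seq L j))
        (ℚ.≤-trans (ℚ.+-mono-≤ p q) (ℚ.≤-reflexive (½+½ ε)))))
    (u⇢K _ (½-pos 0<ε)) (v⇢L _ (½-pos 0<ε))

⇢-∑ : ∀ m {u : ℕ → ℕ → ℝ} {L : ℕ → ℝ} → (∀ j → u j ⇢ L j) → (λ n → ∑[ j < m ] u j n) ⇢ ∑ m L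
⇢-∑ zero    u⇢L = ⇢-const 0ℝ
⇢-∑ (suc m) {u} {L} u⇢L = ⇢-+ {λ n → ∑[ j < m ] u j n} {u m} {∑ m L} {L m} (⇢-∑ m u⇢L) (u⇢L m)

scale : ∀ {ε B} → 0ℚ ℚ.< B → ε ℚ.* recip B ℚ.* B ≡ ε
scale {ε} {B} 0<B = trans (ℚ.*-assoc ε (recip B) B)
  (trans (cong (ε ℚ.*_) (recip-* 0<B)) (ℚ.*-identityʳ ε))

-- Bounds are assumed only for the limits c and d, so the tolerance does not depend on the term of
-- the sequence. The condition ∣b - d∣ ≤ 1 then bounds b by C + 1.
*-close : ∀ {a b c d B C ε} → 0ℚ ℚ.< B → 0ℚ ℚ.< C →
  let e = ε ℚ.* recip (B ℚ.+ (C ℚ.+ 1ℚ)) in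
  ℚ.∣ c ∣ ℚ.≤ B → ℚ.∣ d ∣ ℚ.≤ C →
  ℚ.∣ a ℚ.- c ∣ ℚ.≤ e → ℚ.∣ b ℚ.- d ∣ ℚ.≤ e → ℚ.∣ b ℚ.- d ∣ ℚ.≤ 1ℚ →
  ℚ.∣ a ℚ.* b ℚ.- c ℚ.* d ∣ ℚ.≤ ε
*-close {a} {b} {c} {d} {B} {C} {ε} 0<B 0<C c≤ d≤ a-c≤ b-d≤ b-d≤1 = begin
  ℚ.∣ a ℚ.* b ℚ.- c ℚ.* d ∣  ≡⟨ ∣-∣-swap (a ℚ.* b) (c ℚ.* d) ⟩
  ℚ.∣ c ℚ.* d ℚ.- a ℚ.* b ∣
    ≤⟨ *-estimate {c} {d} {a} {b} (ℚ.<⇒≤ 0<B) (ℚ.<⇒≤ (+-pos 0<C 0<1)) c≤ b≤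
         (ℚ.≤-trans (ℚ.≤-reflexive (∣-∣-swap c a)) a-c≤) (ℚ.≤-trans (ℚ.≤-reflexive (∣-∣-swap d b)) b-d≤) ⟩
  ε ℚ.* recip (B ℚ.+ (C ℚ.+ 1ℚ)) ℚ.* (B ℚ.+ (C ℚ.+ 1ℚ))
    ≡⟨ scale (+-pos 0<B (+-pos 0<C 0<1)) ⟩
  ε ∎
  where
  open ℚ.≤-Reasoning
  b≤ : ℚ.∣ b ∣ ℚ.≤ C ℚ.+ 1ℚ
  b≤ = ℚ.≤-trans
    (ℚ.≤-reflexive (cong ℚ.∣_∣ (solve 2 (λ b d → b := d :+ (b :- d)) refl b d)))
    (ℚ.≤-trans (ℚ.∣p+q∣≤∣p∣+∣q∣ d (b ℚ.- d)) (ℚ.+-mono-≤ d≤ b-d≤1))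

⇢-* : ∀ {u v K L} → u ⇢ K → v ⇢ L → (λ n → u n * v n) ⇢ K * L
⇢-* {u} {v} {K} {L} u⇢K v⇢L ε 0<ε = go (bounded K) (bounded L)
  where
  go : ∃[ B ] 0ℚ ℚ.< B × Eventually (λ j → ℚ.∣ seq K j ∣ ℚ.≤ B) →
       ∃[ C ] 0ℚ ℚ.< C × Eventually (λ j → ℚ.∣ seq L j ∣ ℚ.≤ C) →
       Eventually (λ n → Near ε (u n * v n) (K * L))
  go (B , 0<B , K≤B) (C , 0<C , L≤C) =
    map₂ (λ n u~K (v~L , v~L′) →
        map₂ (λ j (k , l) (p , q , r) → *-close {seq (u n) j} {seq (v n) j} {seq K j} 0<B 0<C k l p q r)
          (both K≤B L≤C) (both u~K (both v~L v~L′)))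
      -- The convergence of v is used twice: with tolerance e for the estimate, with tolerance 1 to
      -- bound v n.
      (u⇢K e 0<e) (both (v⇢L e 0<e) (v⇢L 1ℚ 0<1))
    where
    e : ℚ
    e = ε ℚ.* recip (B ℚ.+ (C ℚ.+ 1ℚ))
    0<e : 0ℚ ℚ.< e
    0<e = *-pos 0<ε (recip-pos (+-pos 0<B (+-pos 0<C 0<1)))

ι-suc : ∀ n → ι (suc n) ≡ ι n ℚ.+ 1ℚ
ι-suc n = ℚ.toℚᵘ-injective (ℚᵘ.≃-trans (toℚᵘ-ι (suc n)) (ℚᵘ.≃-sym
  (ℚᵘ.≃-trans (ℚ.toℚᵘ-homo-+ (ι n) 1ℚ) (ℚᵘ.≃-trans (ℚᵘ.+-cong (toℚᵘ-ι n) (ℚᵘ.≃-refl))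
    (ℚᵘ.*≡* (cong (ℤ._* ℤ.+ 1)
      (trans (cong (ℤ._+ ℤ.+ 1) (ℤ.*-identityʳ (ℤ.+ n))) (cong ℤ.+_ (ℕ.+-comm n 1)))))))))

-- The errors add up to N times ε, so summands accurate to order 1/N² are needed for a total error
-- of order 1/N.
near-∑ : ∀ N {ε} {f g : ℕ → ℝ} → (∀ n → n ℕ.< N → Near ε (f n) (g n)) →
  Near (ι N ℚ.* ε) (∑ N f) (∑ N g)
near-∑ zero    {ε} f~g = 0 , λ _ _ → ℚ.≤-reflexive (sym (ℚ.*-zeroˡ ε))
near-∑ (suc N) {ε} {f} {g} f~g = map₂ (λ j p q → ℚ.≤-trans
    (ℚ.≤-reflexive (cong ℚ.∣_∣
      (solve 4 (λ a b c d → (a :+ b) :- (c :+ d) := (a :- c) :+ (b :- d)) refl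
        (seq (∑ N f) j) (seq (f N) j) (seq (∑ N g) j) (seq (g N) j))))
    (ℚ.≤-trans (ℚ.∣p+q∣≤∣p∣+∣q∣ (seq (∑ N f) j ℚ.- seq (∑ N g) j) (seq (f N) j ℚ.- seq (g N) j))
      (ℚ.≤-trans (ℚ.+-mono-≤ p q) (ℚ.≤-reflexive (trans
        (solve 2 (λ n e → n :* e :+ e := (n :+ con 1ℚ) :* e) refl (ι N) ε)
        (cong (ℚ._* ε) (sym (ι-suc N))))))))
  (near-∑ N (λ n n<N → f~g n (ℕ.m≤n⇒m≤1+n n<N))) (f~g N ℕ.≤-refl)

-- Rational estimates

1/suc² : ℕ → ℚ
1/suc² n = 1/suc n ℚ.* 1/suc n

1/suc²-pos : ∀ n → 0ℚ ℚ.< 1/suc² n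
1/suc²-pos n = *-pos (1/suc-pos n) (1/suc-pos n)

1/suc≤1 : ∀ n → 1/suc n ℚ.≤ 1ℚ
1/suc≤1 n = subst₂ ℚ._≤_ (ℚ.*-identityʳ (1/suc n)) (1/suc-* n)
  (ℚ.*-monoˡ-≤-nonNeg (1/suc n) {{ℚ.nonNegative (ℚ.<⇒≤ (1/suc-pos n))}} (ι-mono {1} {suc n} (s≤s z≤n)))

1/suc²≤1/suc : ∀ n → 1/suc² n ℚ.≤ 1/suc n
1/suc²≤1/suc n = ℚ.≤-trans
  (ℚ.*-monoˡ-≤-nonNeg (1/suc n) {{ℚ.nonNegative (ℚ.<⇒≤ (1/suc-pos n))}} (1/suc≤1 n))
  (ℚ.≤-reflexive (ℚ.*-identityʳ (1/suc n)))

p*p≤p^2k : ∀ {p} k {{_ : NonZero k}} → 1ℚ ℚ.≤ p → p ℚ.* p ℚ.≤ p ^ℚ (2 ℕ.* k)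
-- Moving the inner successor of `2 ℕ.* suc k` outwards exposes the second factor p.
p*p≤p^2k {p} (suc k) 1≤p = subst (λ e → p ℚ.* p ℚ.≤ p ℚ.* p ^ℚ e) (sym (ℕ.+-suc k (k ℕ.+ 0)))
  (ℚ.*-monoˡ-≤-nonNeg p {{ℚ.nonNegative (ℚ.≤-trans (ℚ.<⇒≤ 0<1) 1≤p)}} (p≤^suc (k ℕ.+ (k ℕ.+ 0)) 1≤p))

alternating-assoc : ∀ N y (r : ℕ → ℚ) → ∑ℚ N (λ i → sgn i ℚ.* y ℚ.* r i) ≡ ∑ℚ N (λ i → sgn i ℚ.* (y ℚ.* r i))
alternating-assoc N y r = ∑ℚ-cong N (λ i _ → ℚ.*-assoc (sgn i) y (r i))

-- Here I is a limit, P the partial sum in use and P′ a much later one that links them. The factor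
-- 1/κ^(m+1) in the first tolerance cancels the bound κ^(m+1) on the weight, so this error
-- contributes at most c.
weighted-close : ∀ m n {y κ c I P P′} → 0ℚ ℚ.< y → 0ℚ ℚ.< κ → 0ℚ ℚ.< c → recip y ℚ.≤ κ →
  ℚ.∣ P′ ℚ.- I ∣ ℚ.≤ c ℚ.* recip (κ ^ℚ suc m) → ℚ.∣ P′ ℚ.- P ∣ ℚ.≤ y ℚ.* c →
  ℚ.∣ sgn n ℚ.* recip y ^ℚ suc m ℚ.* I ℚ.- sgn n ℚ.* recip y ^ℚ suc m ℚ.* P ∣ ℚ.≤ (1ℚ ℚ.+ κ ^ℚ m) ℚ.* c
weighted-close m n {y} {κ} {c} {I} {P} {P′} 0<y 0<κ 0<c u≤κ P′~I P′~P = begin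
  ℚ.∣ sgn n ℚ.* w ℚ.* I ℚ.- sgn n ℚ.* w ℚ.* P ∣
    ≡⟨ cong ℚ.∣_∣ (solve 4 (λ s w i p → s :* w :* i :- s :* w :* p := s :* (w :* (i :- p))) refl (sgn n) w I P) ⟩
  ℚ.∣ sgn n ℚ.* (w ℚ.* (I ℚ.- P)) ∣
    ≡⟨ trans (ℚ.∣p*q∣≡∣p∣*∣q∣ (sgn n) (w ℚ.* (I ℚ.- P))) (cong₂ ℚ._*_ (∣sgn∣ n) (ℚ.∣p*q∣≡∣p∣*∣q∣ w (I ℚ.- P))) ⟩
  1ℚ ℚ.* (ℚ.∣ w ∣ ℚ.* ℚ.∣ I ℚ.- P ∣)
    ≡⟨ trans (ℚ.*-identityˡ _) (cong (ℚ._* ℚ.∣ I ℚ.- P ∣) (ℚ.0≤p⇒∣p∣≡p (ℚ.<⇒≤ 0<w))) ⟩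
  w ℚ.* ℚ.∣ I ℚ.- P ∣
    ≤⟨ ℚ.*-monoˡ-≤-nonNeg w {{ℚ.nonNegative (ℚ.<⇒≤ 0<w)}}
         (ℚ.≤-trans (triangle I P′ P)
           (ℚ.+-mono-≤ (ℚ.≤-trans (ℚ.≤-reflexive (∣-∣-swap I P′)) P′~I) P′~P)) ⟩
  w ℚ.* (c ℚ.* recip (κ ^ℚ suc m) ℚ.+ y ℚ.* c)
    ≡⟨ solve 5 (λ u v c r y → u :* v :* (c :* r :+ y :* c) := u :* v :* (c :* r) :+ v :* (u :* y :* c)) refl
         u (u ^ℚ m) c (recip (κ ^ℚ suc m)) y ⟩
  w ℚ.* (c ℚ.* recip (κ ^ℚ suc m)) ℚ.+ u ^ℚ m ℚ.* (u ℚ.* y ℚ.* c)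
    -- The factor y of the tail bound absorbs one power of 1/y, so what remains is bounded by κ^m
    -- whatever the size of y.
    ≡⟨ cong (λ t → w ℚ.* (c ℚ.* recip (κ ^ℚ suc m)) ℚ.+ u ^ℚ m ℚ.* (t ℚ.* c)) (recip-* 0<y) ⟩
  w ℚ.* (c ℚ.* recip (κ ^ℚ suc m)) ℚ.+ u ^ℚ m ℚ.* (1ℚ ℚ.* c)
    ≤⟨ ℚ.+-mono-≤
         (ℚ.*-monoʳ-≤-nonNeg (c ℚ.* recip (κ ^ℚ suc m))
           {{ℚ.nonNegative (ℚ.<⇒≤ (*-pos 0<c (recip-pos (^-pos (suc m) 0<κ))))}} (^-mono-≤ (suc m) 0<u u≤κ))
         (ℚ.*-monoʳ-≤-nonNeg (1ℚ ℚ.* c) {{ℚ.nonNegative (ℚ.<⇒≤ (*-pos 0<1 0<c))}} (^-mono-≤ m 0<u u≤κ)) ⟩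
  κ ^ℚ suc m ℚ.* (c ℚ.* recip (κ ^ℚ suc m)) ℚ.+ κ ^ℚ m ℚ.* (1ℚ ℚ.* c)
    ≡⟨ solve 4 (λ k c r l → k :* (c :* r) :+ l :* (con 1ℚ :* c) := (r :* k :+ l) :* c) refl
         (κ ^ℚ suc m) c (recip (κ ^ℚ suc m)) (κ ^ℚ m) ⟩
  (recip (κ ^ℚ suc m) ℚ.* κ ^ℚ suc m ℚ.+ κ ^ℚ m) ℚ.* c
    ≡⟨ cong (λ t → (t ℚ.+ κ ^ℚ m) ℚ.* c) (recip-* (^-pos (suc m) 0<κ)) ⟩
  (1ℚ ℚ.+ κ ^ℚ m) ℚ.* c ∎
  where
  open ℚ.≤-Reasoning
  u w : ℚ
  u = recip y
  w = u ^ℚ suc m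
  0<u : 0ℚ ℚ.< u
  0<u = recip-pos 0<y
  0<w : 0ℚ ℚ.< w
  0<w = ^-pos (suc m) 0<u

-- The powers (n + x)²ᵏ and the tails of the inner series

base : ℕ → ℚ → ℕ → ℚ
base k x n = (ι n ℚ.+ x) ^ℚ (2 ℕ.* k)

0≤ι : ∀ n → 0ℚ ℚ.≤ ι n
0≤ι n = ι-mono {0} {n} z≤n

module _ (k : ℕ) {x : ℚ} (0<x : 0ℚ ℚ.< x) where

  0<ι+x : ∀ n → 0ℚ ℚ.< ι n ℚ.+ x
  0<ι+x n = ℚ.<-≤-trans 0<x (p≤q+p (0≤ι n))

  base-pos : ∀ n → 0ℚ ℚ.< base k x n
  base-pos n = ^-pos (2 ℕ.* k) (0<ι+x n)

  base-mono : ∀ n → base k x n ℚ.≤ base k x (suc n)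
  base-mono n = ^-mono-≤ (2 ℕ.* k) (0<ι+x n) (ℚ.+-monoˡ-≤ x (ι-mono (ℕ.n≤1+n n)))

  -- The bound depends only on the lower bound η, hence is uniform in n and in the approximation x.
  recip-base≤ : ∀ {η} → 0ℚ ℚ.< η → η ℚ.≤ x → ∀ n → recip (base k x n) ℚ.≤ recip (η ^ℚ (2 ℕ.* k))
  recip-base≤ 0<η η≤x n = recip-anti (^-pos (2 ℕ.* k) 0<η)
    (^-mono-≤ (2 ℕ.* k) 0<η (ℚ.≤-trans η≤x (p≤q+p (0≤ι n))))

  -- Since n + 1 + x ≥ 1 and 2k ≥ 2, the power is at least (n + 1)². The shift to `suc n` secures
  -- the first inequality for small x.
  recip-base-suc≤ : {{_ : NonZero k}} → ∀ n → recip (base k x (suc n)) ℚ.≤ 1/suc² n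
  recip-base-suc≤ n = recip≤ (base-pos (suc n)) (begin
    1ℚ ℚ.* 1ℚ                                    ≡⟨ cong₂ ℚ._*_ (1/suc-* n) (1/suc-* n) ⟨
    r ℚ.* ι (suc n) ℚ.* (r ℚ.* ι (suc n))        ≡⟨ solve 2 (λ r i → r :* i :* (r :* i) := r :* r :* (i :* i)) refl r (ι (suc n)) ⟩
    1/suc² n ℚ.* (ι (suc n) ℚ.* ι (suc n))
      ≤⟨ ℚ.*-monoˡ-≤-nonNeg (1/suc² n) {{ℚ.nonNegative (ℚ.<⇒≤ (1/suc²-pos n))}}
           (ℚ.≤-trans (*-mono-≤ (0≤ι (suc n)) (ℚ.<⇒≤ (0<ι+x (suc n))) ι≤ ι≤)
             (p*p≤p^2k k (ℚ.≤-trans (ι-mono {1} {suc n} (s≤s z≤n)) ι≤))) ⟩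
    1/suc² n ℚ.* base k x (suc n)                ∎)
    where
    open ℚ.≤-Reasoning
    r : ℚ
    r = 1/suc n
    ι≤ : ι (suc n) ℚ.≤ ι (suc n) ℚ.+ x
    ι≤ = p≤p+q (ℚ.<⇒≤ 0<x)

  -- The terms y / (y + yᵢ) decrease in i, so the alternating tail is at most its first term, at i =
  -- N + 1.
  inner-tail≤ : {{_ : NonZero k}} → ∀ n {N M} → suc N ℕ.≤ M →
    let P = λ M → ∑ℚ M (λ i → sgn i ℚ.* base k x n ℚ.* recip (base k x n ℚ.+ base k x i)) in
    ℚ.∣ P M ℚ.- P (suc N) ∣ ℚ.≤ base k x n ℚ.* 1/suc² N
  inner-tail≤ n {N} {M} N<M = begin
    ℚ.∣ P M ℚ.- P (suc N) ∣
      ≡⟨ cong ℚ.∣_∣ (cong₂ ℚ._-_ (alternating-assoc M y r) (alternating-assoc (suc N) y r)) ⟩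
    ℚ.∣ ∑ℚ M (λ i → sgn i ℚ.* (y ℚ.* r i)) ℚ.- ∑ℚ (suc N) (λ i → sgn i ℚ.* (y ℚ.* r i)) ∣
      ≤⟨ ∣tail∣≤ (λ i → y ℚ.* r i) b≥0 b↘ (suc N) M N<M ⟩
    y ℚ.* r (suc N)
      -- Only the y in the denominator is discarded; the one in front is kept, for the weight to
      -- cancel.
      ≤⟨ y*-mono (ℚ.≤-trans (recip-anti (base-pos (suc N)) (p≤q+p (ℚ.<⇒≤ (base-pos n)))) (recip-base-suc≤ N)) ⟩
    y ℚ.* 1/suc² N ∎
    where
    open ℚ.≤-Reasoning
    y : ℚ
    y = base k x n
    r : ℕ → ℚ
    r i = recip (y ℚ.+ base k x i)
    P : ℕ → ℚ
    P M = ∑ℚ M (λ i → sgn i ℚ.* y ℚ.* r i)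
    0<y+ : ∀ i → 0ℚ ℚ.< y ℚ.+ base k x i
    0<y+ i = +-pos (base-pos n) (base-pos i)
    y*-mono : ∀ {p q} → p ℚ.≤ q → y ℚ.* p ℚ.≤ y ℚ.* q
    y*-mono = ℚ.*-monoˡ-≤-nonNeg y {{ℚ.nonNegative (ℚ.<⇒≤ (base-pos n))}}
    b≥0 : ∀ i → 0ℚ ℚ.≤ y ℚ.* r i
    b≥0 i = ℚ.<⇒≤ (*-pos (base-pos n) (recip-pos (0<y+ i)))
    b↘ : ∀ i → y ℚ.* r (suc i) ℚ.≤ y ℚ.* r i
    b↘ i = y*-mono (recip-anti (0<y+ i) (ℚ.+-monoʳ-≤ y (base-mono i)))

  -- The exponent 4k(q + 1) factors as 2k(2q + 2).
  weight≡ : ∀ q n → recip ((ι n ℚ.+ x) ^ℚ (4 ℕ.* k ℕ.* (q ℕ.+ 1))) ≡ recip (base k x n) ^ℚ suc (suc (2 ℕ.* q))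
  weight≡ q n = trans
    (cong (λ e → recip ((ι n ℚ.+ x) ^ℚ e))
      (ℕ-Solver.solve 2 (λ k q → ℕ-Solver.con 4 ℕ-Solver.:* k ℕ-Solver.:* (q ℕ-Solver.:+ ℕ-Solver.con 1)
        ℕ-Solver.:= (ℕ-Solver.con 2 ℕ-Solver.:* k) ℕ-Solver.:* (ℕ-Solver.con 2 ℕ-Solver.:+ ℕ-Solver.con 2 ℕ-Solver.:* q)) refl k q))
    (recip-^-* (2 ℕ.* k) (suc (suc (2 ℕ.* q))) (0<ι+x n))

  square-sum-ζ : ∀ q N →
    ∑ℚ N (λ n → sgn n ℚ.* recip ((ι n ℚ.+ x) ^ℚ (4 ℕ.* k ℕ.* (q ℕ.+ 1)))
                 ℚ.* ∑ℚ N (λ i → sgn i ℚ.* base k x n ℚ.* recip (base k x n ℚ.+ base k x i)))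
      ≡ ½ ℚ.* ∑ℚ (2 ℕ.* q ℕ.+ 1) (λ j → sgn (suc j ℕ.+ 1)
                 ℚ.* ∑ℚ N (λ n → sgn n ℚ.* recip ((ι n ℚ.+ x) ^ℚ (2 ℕ.* k ℕ.* suc j)))
                 ℚ.* ∑ℚ N (λ i → sgn i ℚ.* recip ((ι i ℚ.+ x) ^ℚ (2 ℕ.* k ℕ.* suc (2 ℕ.* q ∸ j)))))
  square-sum-ζ q N = begin
    _ ≡⟨ ∑ℚ-cong N (λ n _ → cong (λ w → sgn n ℚ.* w ℚ.* ∑ℚ N (λ i → sgn i ℚ.* base k x n ℚ.* recip (base k x n ℚ.+ base k x i))) (weight≡ q n)) ⟩
    _ ≡⟨ square-sum q N sgn (base k x) base-pos ⟩
    _ ≡⟨ cong (½ ℚ.*_) (∑ℚ-cong (suc (2 ℕ.* q)) (λ j _ → cong₂ ℚ._*_ (cong₂ ℚ._*_ (sym (sgn-2+ j)) (Z j)) (Z (2 ℕ.* q ∸ j)))) ⟩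
    -- The theorem's range `2 ℕ.* q ℕ.+ 1` is not definitionally the successor used by `square-sum`.
    _ ≡⟨ cong (λ m → ½ ℚ.* ∑ℚ m (λ j → sgn (suc j ℕ.+ 1)
                 ℚ.* ∑ℚ N (λ n → sgn n ℚ.* recip ((ι n ℚ.+ x) ^ℚ (2 ℕ.* k ℕ.* suc j)))
                 ℚ.* ∑ℚ N (λ i → sgn i ℚ.* recip ((ι i ℚ.+ x) ^ℚ (2 ℕ.* k ℕ.* suc (2 ℕ.* q ∸ j)))))) (ℕ.+-comm 1 (2 ℕ.* q)) ⟩
    _ ∎
    where
    open ≡-Reasoning
    Z : ∀ j → ∑ℚ N (λ n → sgn n ℚ.* recip (base k x n) ^ℚ suc j)
      ≡ ∑ℚ N (λ n → sgn n ℚ.* recip ((ι n ℚ.+ x) ^ℚ (2 ℕ.* k ℕ.* suc j)))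
    Z j = ∑ℚ-cong N (λ n _ → cong (sgn n ℚ.*_) (sym (recip-^-* (2 ℕ.* k) (suc j) (0<ι+x n))))

-- The double series

near-≡ : ∀ {δ ε x y z} → δ ℚ.≤ ε → Near δ x y → Eventually (λ j → seq y j ≡ seq z j) → Near ε x z
near-≡ {δ} {ε} {x} {y} {z} δ≤ε = map₂ λ j p y≡z →
  ℚ.≤-trans (subst (λ t → ℚ.∣ seq x j ℚ.- t ∣ ℚ.≤ δ) y≡z p) δ≤ε

module _ (k : ℕ) {{_ : NonZero k}} (a : ℝ) {{a>0 : 0ℝ < a}} where

  open _<_ a>0 using () renaming (gap to η; 0<gap to 0<η; from to J; gap≤ to η≤)

  term : ℕ → ℕ → ℝ
  term n i = (- 1ℝ) ^ i * (fromℕ n + a) ^ (2 ℕ.* k)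
               / ((fromℕ n + a) ^ (2 ℕ.* k) + (fromℕ i + a) ^ (2 ℕ.* k))

  partial : ℕ → ℕ → ℝ
  partial n N = ∑[ i < N ] term n i

  η≤a : ∀ j → J ℕ.≤ j → η ℚ.≤ seq a j
  η≤a j J≤j = ℚ.≤-trans (ℚ.≤-reflexive (sym (ℚ.+-identityˡ η))) (η≤ j J≤j)

  a-pos : ∀ j → J ℕ.≤ j → 0ℚ ℚ.< seq a j
  a-pos j J≤j = ℚ.<-≤-trans 0<η (η≤a j J≤j)

  partial-tail : ∀ n N M → suc N ℕ.≤ M → ∀ j → J ℕ.≤ j →
    ℚ.∣ seq (partial n M) j ℚ.- seq (partial n (suc N)) j ∣ ℚ.≤ base k (seq a j) n ℚ.* 1/suc² N
  partial-tail n N M N<M j J≤j = subst (ℚ._≤ base k (seq a j) n ℚ.* 1/suc² N)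
    (cong ℚ.∣_∣ (sym (cong₂ ℚ._-_ (seq-∑ M (term n) j) (seq-∑ (suc N) (term n) j))))
    (inner-tail≤ k (a-pos j J≤j) n N<M)

  -- The tail bound carries the factor (n + a)²ᵏ. For fixed n its approximations are eventually at
  -- most some B, so requiring 1/(m + 1) ≤ ε / B suffices.
  partial-cauchy : ∀ n → Cauchy (partial n)
  partial-cauchy n = near⇒Cauchy {partial n} λ ε 0<ε → go ε 0<ε (bounded ((fromℕ n + a) ^ (2 ℕ.* k)))
    where
    go : ∀ ε → 0ℚ ℚ.< ε →
      ∃[ B ] 0ℚ ℚ.< B × Eventually (λ j → ℚ.∣ base k (seq a j) n ∣ ℚ.≤ B) →
      ∃[ N ] ∀ m M → N ℕ.≤ m → m ℕ.≤ M → Near ε (partial n M) (partial n m)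
    -- The threshold is a successor because the tail bound is stated for tails starting at a
    -- successor.
    go ε 0<ε (B , 0<B , K , y≤B) = suc N , close
      where
      e : ℚ
      e = ε ℚ.* recip B
      small : ∃[ N ] ∀ m → N ℕ.≤ m → 1/suc m ℚ.≤ e
      small = archimedean e (*-pos 0<ε (recip-pos 0<B))
      N : ℕ
      N = proj₁ small
      close : ∀ m M → suc N ℕ.≤ m → m ℕ.≤ M → Near ε (partial n M) (partial n m)
      close (suc m) M (s≤s N≤m) m<M = J ℕ.⊔ K , λ j ≤j → ℚ.≤-trans
        (partial-tail n m M m<M j (⊔ˡ ≤j))
        (ℚ.≤-trans
          (*-mono-≤ (ℚ.<⇒≤ (1/suc²-pos m)) (ℚ.<⇒≤ 0<B)
            (ℚ.≤-trans (p≤∣p∣ _) (y≤B j (⊔ʳ {J} ≤j)))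
            (ℚ.≤-trans (1/suc²≤1/suc m) (proj₂ small m N≤m)))
          (ℚ.≤-reflexive (trans (ℚ.*-comm B e) (scale 0<B))))

  inner : ℕ → ℝ
  inner n = proj₁ (complete (partial n) (partial-cauchy n))

  inner-sum : ∀ n → term n sumsTo inner n
  inner-sum n = proj₂ (complete (partial n) (partial-cauchy n))

  -- Truncating the weighted double series to a square

  module _ (q : ℕ) where

    weight : ℕ → ℝ
    weight n = (- 1ℝ) ^ n / (fromℕ n + a) ^ (4 ℕ.* k ℕ.* (q ℕ.+ 1))

    -- `κ` bounds 1/(n + a)²ᵏ for every n at all approximations past `J`; `C` is the constant that
    -- `weighted-close` yields for m = 2q + 1.
    κ C : ℚ
    κ = recip (η ^ℚ (2 ℕ.* k))
    C = 1ℚ ℚ.+ κ ^ℚ suc (2 ℕ.* q)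

    0<κ : 0ℚ ℚ.< κ
    0<κ = recip-pos (^-pos (2 ℕ.* k) 0<η)

    0<C : 0ℚ ℚ.< C
    0<C = +-pos 0<1 (^-pos (suc (2 ℕ.* q)) 0<κ)

    summand-near : ∀ n N → Near (C ℚ.* 1/suc² N) (weight n * inner n) (weight n * partial n (suc N))
    summand-near n N = go (⟶⇒⇢ {partial n} {inner n} (inner-sum n) δ 0<δ)
      where
      δ : ℚ
      δ = 1/suc² N ℚ.* recip (κ ^ℚ suc (suc (2 ℕ.* q)))
      0<δ : 0ℚ ℚ.< δ
      0<δ = *-pos (1/suc²-pos N) (recip-pos (^-pos (suc (suc (2 ℕ.* q))) 0<κ))
      go : Eventually (λ M → Near δ (partial n M) (inner n)) →
        Near (C ℚ.* 1/suc² N) (weight n * inner n) (weight n * partial n (suc N))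
      go (M₀ , near) = J ℕ.⊔ proj₁ near-M , λ j ≤j → estimate j (⊔ˡ ≤j) (proj₂ near-M j (⊔ʳ {J} ≤j))
        where
        M : ℕ
        -- Past M₀ the partial sum is within δ of `inner n`; from N + 1 on the tail bound compares
        -- it with the sum of N + 1 terms.
        M = M₀ ℕ.⊔ suc N
        near-M : Near δ (partial n M) (inner n)
        near-M = near M (ℕ.m≤m⊔n M₀ (suc N))
        estimate : ∀ j → J ℕ.≤ j → ℚ.∣ seq (partial n M) j ℚ.- seq (inner n) j ∣ ℚ.≤ δ →
          ℚ.∣ seq (weight n * inner n) j ℚ.- seq (weight n * partial n (suc N)) j ∣ ℚ.≤ C ℚ.* 1/suc² N
        estimate j J≤j p = subst
          (λ w → ℚ.∣ sgn n ℚ.* w ℚ.* seq (inner n) j ℚ.- sgn n ℚ.* w ℚ.* seq (partial n (suc N)) j ∣ ℚ.≤ C ℚ.* 1/suc² N)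
          (sym (weight≡ k (a-pos j J≤j) q n))
          (weighted-close (suc (2 ℕ.* q)) n {P′ = seq (partial n M) j} (base-pos k (a-pos j J≤j) n) 0<κ (1/suc²-pos N)
            (recip-base≤ k (a-pos j J≤j) 0<η (η≤a j J≤j) n) p
            (partial-tail n N M (ℕ.m≤n⊔m M₀ (suc N)) j J≤j))

    -- In `square` both sums stop at the same N, which makes the index set symmetric and
    -- `square-sum` applicable.
    outer square : ℕ → ℝ
    outer N = ∑[ n < N ] (weight n * inner n)
    square N = ∑[ n < N ] (weight n * partial n N)

    -- There are N + 1 summands, each with error at most C/(N + 1)².
    outer-near-square : ∀ N → Near (C ℚ.* 1/suc N) (outer (suc N)) (square (suc N))
    outer-near-square N = subst (λ e → Near e (outer (suc N)) (square (suc N)))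
      (trans (solve 3 (λ i c r → i :* (c :* (r :* r)) := c :* (r :* i :* r)) refl (ι (suc N)) C (1/suc N))
        (cong (C ℚ.*_) (trans (cong (ℚ._* 1/suc N) (1/suc-* N)) (ℚ.*-identityˡ (1/suc N)))))
      (near-∑ (suc N) {C ℚ.* 1/suc² N} {λ n → weight n * inner n} {λ n → weight n * partial n (suc N)}
        (λ n _ → summand-near n N))

    -- Products of partial zeta sums and passage to the limit

    ζ-partial : ℕ → ℕ → ℝ
    ζ-partial s N = ∑[ n < N ] ζE-term s a n

    ζ-products : ℕ → ℝ
    ζ-products N = fromℚ ½ * (∑[ j < 2 ℕ.* q ℕ.+ 1 ]
      ((- 1ℝ) ^ (suc j ℕ.+ 1) * ζ-partial (2 ℕ.* k ℕ.* suc j) N * ζ-partial (2 ℕ.* k ℕ.* suc (2 ℕ.* q ∸ j)) N))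

    -- An exact identity between finite sums of rationals; the index must pass `J` so that the
    -- approximation of a is positive and the reciprocals are genuine.
    square≡ζ-products : ∀ N j → J ℕ.≤ j → seq (square N) j ≡ seq (ζ-products N) j
    square≡ζ-products N j J≤j = begin
      seq (square N) j
        ≡⟨ seq-∑ N (λ n → weight n * partial n N) j ⟩
      _ ≡⟨ ∑ℚ-cong N (λ n _ → cong (seq (weight n) j ℚ.*_) (seq-∑ N (term n) j)) ⟩
      _ ≡⟨ square-sum-ζ k (a-pos j J≤j) q N ⟩
      _ ≡⟨ cong (½ ℚ.*_) (∑ℚ-cong (2 ℕ.* q ℕ.+ 1) (λ i _ → cong₂ (λ s t → sgn (suc i ℕ.+ 1) ℚ.* s ℚ.* t)
             (seq-∑ N (ζE-term (2 ℕ.* k ℕ.* suc i) a) j)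
             (seq-∑ N (ζE-term (2 ℕ.* k ℕ.* suc (2 ℕ.* q ∸ i)) a) j))) ⟨
      _ ≡⟨ cong (½ ℚ.*_) (seq-∑ (2 ℕ.* q ℕ.+ 1) (λ i → (- 1ℝ) ^ (suc i ℕ.+ 1)
             * ζ-partial (2 ℕ.* k ℕ.* suc i) N * ζ-partial (2 ℕ.* k ℕ.* suc (2 ℕ.* q ∸ i)) N) j) ⟨
      seq (ζ-products N) j ∎
      where open ≡-Reasoning

    ζ-partial⇢ : ∀ p → ζ-partial (2 ℕ.* k ℕ.* suc p) ⇢ ζE (2 ℕ.* k ℕ.* suc p) {{2kp≢0 k (suc p)}} a
    ζ-partial⇢ p = ⟶⇒⇢ {ζ-partial (2 ℕ.* k ℕ.* suc p)} {ζE (2 ℕ.* k ℕ.* suc p) {{2kp≢0 k (suc p)}} a}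
      (ζE-sum (2 ℕ.* k ℕ.* suc p) {{2kp≢0 k (suc p)}} a)

    limit : ℕ → ℝ
    limit j = (- 1ℝ) ^ (suc j ℕ.+ 1)
      * ζE (2 ℕ.* k ℕ.* suc j) {{2kp≢0 k (suc j)}} a
      * ζE (2 ℕ.* k ℕ.* suc (2 ℕ.* q ∸ j)) {{2kp≢0 k (suc (2 ℕ.* q ∸ j))}} a

    -- The number of products, 2q + 1, does not grow with N, so the limit laws apply term by term.
    ζ-products⇢ : ζ-products ⇢ fromℚ ½ * ∑ (2 ℕ.* q ℕ.+ 1) limit
    ζ-products⇢ = ⇢-* {λ _ → fromℚ ½} {λ N → ∑[ j < 2 ℕ.* q ℕ.+ 1 ] (signed j N * ζ-partial (t j) N)} {fromℚ ½} {∑ (2 ℕ.* q ℕ.+ 1) limit}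
      (⇢-const (fromℚ ½))
      (⇢-∑ (2 ℕ.* q ℕ.+ 1) {λ j N → signed j N * ζ-partial (t j) N} {limit} λ j →
        ⇢-* {signed j} {ζ-partial (t j)} {(- 1ℝ) ^ (suc j ℕ.+ 1) * ζE (s j) {{2kp≢0 k (suc j)}} a}
            {ζE (t j) {{2kp≢0 k (suc (2 ℕ.* q ∸ j))}} a}
          (⇢-* {λ _ → (- 1ℝ) ^ (suc j ℕ.+ 1)} {ζ-partial (s j)} {(- 1ℝ) ^ (suc j ℕ.+ 1)} {ζE (s j) {{2kp≢0 k (suc j)}} a}
            (⇢-const ((- 1ℝ) ^ (suc j ℕ.+ 1))) (ζ-partial⇢ j))
          (ζ-partial⇢ (2 ℕ.* q ∸ j)))
      where
      s t : ℕ → ℕ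
      s j = 2 ℕ.* k ℕ.* suc j
      t j = 2 ℕ.* k ℕ.* suc (2 ℕ.* q ∸ j)
      signed : ℕ → ℕ → ℝ
      signed j N = (- 1ℝ) ^ (suc j ℕ.+ 1) * ζ-partial (s j) N

    outer-near-ζ-products : ∀ ε → 0ℚ ℚ.< ε → Eventually (λ N → Near ε (outer N) (ζ-products N))
    outer-near-ζ-products ε 0<ε = suc (proj₁ small) , close
      where
      e : ℚ
      e = ε ℚ.* recip C
      small : ∃[ N ] ∀ m → N ℕ.≤ m → 1/suc m ℚ.≤ e
      small = archimedean e (*-pos 0<ε (recip-pos 0<C))
      close : ∀ N → suc (proj₁ small) ℕ.≤ N → Near ε (outer N) (ζ-products N)
      close (suc N) (s≤s ≤N) = near-≡ {C ℚ.* 1/suc N} {ε} {outer (suc N)} {square (suc N)} {ζ-products (suc N)}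
        C/suc≤ε (outer-near-square N) (J , square≡ζ-products (suc N))
        where
        C/suc≤ε : C ℚ.* 1/suc N ℚ.≤ ε
        C/suc≤ε = ℚ.≤-trans
          (ℚ.*-monoˡ-≤-nonNeg C {{ℚ.nonNegative (ℚ.<⇒≤ 0<C)}} (proj₂ small N ≤N))
          (ℚ.≤-reflexive (trans (ℚ.*-comm C e) (scale {ε} 0<C)))

    outer-sum : (λ n → weight n * inner n) sumsTo (fromℚ ½ * ∑ (2 ℕ.* q ℕ.+ 1) limit)
    outer-sum = ⇢⇒⟶ {outer} {fromℚ ½ * ∑ (2 ℕ.* q ℕ.+ 1) limit}
      (⇢-near {ζ-products} {outer} {fromℚ ½ * ∑ (2 ℕ.* q ℕ.+ 1) limit} outer-near-ζ-products ζ-products⇢)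

corollary1p25 : (k q : ℕ) {{_ : NonZero k}} {{_ : NonZero q}} (a : ℝ) {{_ : 0ℝ < a}} →
    Σ[ inner ∈ (ℕ → ℝ) ]
      (∀ n → (λ i → (- 1ℝ) ^ i * (fromℕ n + a) ^ (2 ℕ.* k)
                      / ((fromℕ n + a) ^ (2 ℕ.* k) + (fromℕ i + a) ^ (2 ℕ.* k))) sumsTo inner n)
    × (λ n → (- 1ℝ) ^ n / (fromℕ n + a) ^ (4 ℕ.* k ℕ.* (q ℕ.+ 1)) * inner n)
        sumsTo
      (fromℚ ½ * (∑[ j < 2 ℕ.* q ℕ.+ 1 ]
        -- with p = j + 1 in {1, …, 2q + 1}, one has 2q - p + 2 = (2q - j) + 1
        (let p = suc j in
         (- 1ℝ) ^ (p ℕ.+ 1)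
           * ζE (2 ℕ.* k ℕ.* p) {{2kp≢0 k p}} a
           * ζE (2 ℕ.* k ℕ.* suc (2 ℕ.* q ∸ j)) {{2kp≢0 k (suc (2 ℕ.* q ∸ j))}} a)))
corollary1p25 k q a = inner k a , inner-sum k a , outer-sum k a q
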